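{- There exist LKTSs (large sets of Kirkman triple systems) of orders $93$, $177$, $219$, $261$ and $303$; that is, an LKTS$(v)$ exists for each $v\in\{93,177,219,261,303\}$.
   Context: A Steiner triple system STS$(v)$ is a pair $(X,\mathcal B)$, where $X$ is a $v$-set and $\mathcal B$ is a collection of $3$-subsets (blocks) of $X$ such that every pair of points of $X$ is contained in a unique block. A parallel class is a set of blocks that partitions $X$. An STS$(v)$ is resolvable if $\mathcal B$ can be partitioned into $(v-1)/2$ parallel classes; a resolvable STS$(v)$ is called a Kirkman triple system KTS$(v)$. Two STS$(v)$s on the same point set are disjoint if they have no common block. A large set of Steiner triple systems LSTS$(v)$ is a set of $v-2$ mutually disjoint STS$(v)$s on the same $v$-point set (equivalently, their block sets partition all triples of the point set). An LKTS$(v)$ is an LSTS$(v)$ in which every constituent STS$(v)$ is resolvable. -}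

module Defs where

open import Data.Fin.Base using (Fin)
open import Data.Fin.Subset using (Subset; _∈_; ∣_∣)
open import Data.Nat.Base using (ℕ; _∸_)
open import Data.Nat.DivMod using (_/_)
open import Data.Product using (Σ-syntax; ∃!; _×_)
open import Level using (0ℓ)
open import Relation.Binary.PropositionalEquality using (_≡_; _≢_)
open import Relation.Unary using (Pred; _⊆_; _⊥_)

-- The v-set of points is Fin v.  `Subset v` is a bit vector, so propositional
-- equality of blocks is extensional.
Blocks : ℕ → Set₁
Blocks v = Pred (Subset v) 0ℓ

record IsSTS {v : ℕ} (𝓑 : Blocks v) : Set where
  field
    triples : ∀ {B} → 𝓑 B → ∣ B ∣ ≡ 3
    pairs   : ∀ {x y : Fin v} → x ≢ y →
              ∃! _≡_ (λ B → 𝓑 B × x ∈ B × y ∈ B)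

-- No separate non-emptiness condition on the parts: in a triple system every
-- block has three points.
record IsParallelClass {v : ℕ} (𝓑 P : Blocks v) : Set where
  field
    blocks    : P ⊆ 𝓑
    partition : ∀ (x : Fin v) → ∃! _≡_ (λ B → P B × x ∈ B)

-- The floor in (v ∸ 1) / 2 is harmless: an STS(v) with v > 0 has v odd.
record Resolution {v : ℕ} (𝓑 : Blocks v) : Set₁ where
  field
    class         : Fin ((v ∸ 1) / 2) → Blocks v
    parallelClass : ∀ i → IsParallelClass 𝓑 (class i)
    partition     : ∀ {B} → 𝓑 B → ∃! _≡_ (λ i → class i B)

-- A "set of v - 2" systems is a family over Fin (v ∸ 2); for v ≥ 3 its members
-- are distinct, being disjoint and non-empty.
record IsLSTS {v : ℕ} (𝓢 : Fin (v ∸ 2) → Blocks v) : Set where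
  field
    sts      : ∀ i → IsSTS (𝓢 i)
    disjoint : ∀ {i j} → i ≢ j → 𝓢 i ⊥ 𝓢 j

LKTS : ℕ → Set₁
LKTS v = Σ[ 𝓢 ∈ (Fin (v ∸ 2) → Blocks v) ] IsLSTS 𝓢 × (∀ i → Resolution (𝓢 i))

{-# OPTIONS --safe #-}

-- The orders are 7 q + 2 with q = 13, 25, 31, 37, 43.  Let R = ℤ/7 × 𝔽_q and take the points
-- R ∪ {∞₁ , ∞₂}.  As 3 is a unit, every triple in R has exactly one translate of sum zero.
-- Consider the blocks {x , y , z} of sum zero, {∞ᵢ , x , -2x} with i given by the Legendre
-- symbol modulo 7 of the first coordinate of x, and {0 , ∞₁ , ∞₂}, except that the blocks
-- inside (0 × 𝔽_q) ∪ {∞₁ , ∞₂} are those of a Kirkman triple system whose translates by 𝔽_q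
-- form a large set.  This is a triple system whose translates by R are disjoint.
--
-- It is resolved by a class P₀ containing {0 , ∞₁ , ∞₂} and by the orbits, under groups of
-- units of R, of a class Pᴬ containing {0 , x , -x} for x = (1 , 1), of a class Pᴮ containing
-- it for x = (1 , 0), and of classes Pᶜ extending those of the small system on
-- (0 × 𝔽_q) ∪ {∞₁ , ∞₂}.  These base classes come from a computer search: for Pᴬ, it is an
-- exact cover with one pair of blocks ±B from each remaining orbit of blocks under the units.
-- That the classes form a resolved triple system with disjoint translates is then evaluated.
module Submission where

open import Defs
open import Data.Bool.Base using (Bool; true; false; T; if_then_else_; not; _∧_; _∨_)
open import Data.Bool.ListAction using (all)
open import Data.Bool.Properties using (T-≡; T-∧; T-not-≡)
open import Data.Fin.Base using (Fin; zero; suc; toℕ; splitAt; cast; fromℕ<)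
open import Data.Fin.Properties using (_≟_; any?; cast-involutive; injective⇒≤; splitAt⁻¹-↑ˡ; splitAt⁻¹-↑ʳ; toℕ-fromℕ<; toℕ-injective; toℕ<n)
open import Data.Fin.Subset using (Subset; _∈_; _∉_; ∣_∣; ⁅_⁆; _∪_; inside; outside)
open import Data.Fin.Subset.Properties using (x∈⁅x⁆; x∈⁅y⁆⇒x≡y; ∣⁅x⁆∣≡1; ⊆-antisym; x∈p∪q⁻; x∈p∪q⁺; ∪-identityˡ)
open import Data.List.Base using (List; []; _∷_; _++_; map; length; lookup; foldr; upTo)
open import Data.List.Membership.Propositional.Properties using (∈-upTo⁺)
open import Data.List.Relation.Unary.All as All using ()
open import Data.List.Relation.Unary.All.Properties using (all⁺)
open import Data.Maybe.Base using (Maybe; just; nothing; fromMaybe)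
open import Data.Nat.Base
open import Data.Nat.DivMod
open import Data.Nat.Divisibility using (divides-refl)
open import Data.Nat.Properties using (≡ᵇ⇒≡; ≡⇒≡ᵇ; <ᵇ⇒<; <⇒<ᵇ; _<?_; +-comm; +-identityʳ; +-suc; *-comm; +-monoʳ-<; *-monoˡ-≤; m≤n⇒m≤o+n; m≤n⇒m<n∨m≡n; <-≤-trans; ≤-antisym; ≮⇒≥; 1+n≰n)
open import Data.Nat.Tactic.RingSolver using (solve-∀)
open import Data.Product using (∃; ∃₂; _×_; _,_; proj₁; proj₂)
open import Data.Sum using (_⊎_; inj₁; inj₂; [_,_]′)
open import Data.Vec.Base using (_∷_; here; there)
open import Function.Base using (_∘_)
open import Function.Bundles using (Equivalence)
open import Function.Definitions using (Injective)
open import Relation.Binary.PropositionalEquality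
open import Relation.Nullary using (¬_; yes; no; contradiction)
open import Relation.Nullary.Decidable using (_⊎-dec_)

private variable
  v r : ℕ

-- Three-element subsets.

∣⁅x⁆∪p∣ : ∀ {x : Fin v} {p} → x ∉ p → ∣ ⁅ x ⁆ ∪ p ∣ ≡ suc ∣ p ∣
∣⁅x⁆∪p∣ {x = zero}  {inside  ∷ p} x∉p = contradiction here x∉p
∣⁅x⁆∪p∣ {x = zero}  {outside ∷ p} x∉p = cong (suc ∘ ∣_∣) (∪-identityˡ p)
∣⁅x⁆∪p∣ {x = suc x} {inside  ∷ p} x∉p = cong suc (∣⁅x⁆∪p∣ (x∉p ∘ there))
∣⁅x⁆∪p∣ {x = suc x} {outside ∷ p} x∉p = ∣⁅x⁆∪p∣ (x∉p ∘ there)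

triple : (x y z : Fin v) → Subset v
triple x y z = ⁅ x ⁆ ∪ (⁅ y ⁆ ∪ ⁅ z ⁆)

∈-triple⁻ : ∀ {x y z w : Fin v} → w ∈ triple x y z → w ≡ x ⊎ w ≡ y ⊎ w ≡ z
∈-triple⁻ {x = x} {y} {z} w∈ with x∈p∪q⁻ ⁅ x ⁆ _ w∈
... | inj₁ w∈x = inj₁ (x∈⁅y⁆⇒x≡y x w∈x)
... | inj₂ w∈yz with x∈p∪q⁻ ⁅ y ⁆ _ w∈yz
...   | inj₁ w∈y = inj₂ (inj₁ (x∈⁅y⁆⇒x≡y y w∈y))
...   | inj₂ w∈z = inj₂ (inj₂ (x∈⁅y⁆⇒x≡y z w∈z))

∈-triple⁺ : ∀ {x y z w : Fin v} → w ≡ x ⊎ w ≡ y ⊎ w ≡ z → w ∈ triple x y z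
∈-triple⁺ (inj₁ refl)        = x∈p∪q⁺ (inj₁ (x∈⁅x⁆ _))
∈-triple⁺ (inj₂ (inj₁ refl)) = x∈p∪q⁺ (inj₂ (x∈p∪q⁺ (inj₁ (x∈⁅x⁆ _))))
∈-triple⁺ (inj₂ (inj₂ refl)) = x∈p∪q⁺ (inj₂ (x∈p∪q⁺ (inj₂ (x∈⁅x⁆ _))))

∣triple∣ : ∀ {x y z : Fin v} → x ≢ y → x ≢ z → y ≢ z → ∣ triple x y z ∣ ≡ 3
∣triple∣ {x = x} {y} {z} x≢y x≢z y≢z = begin
  ∣ triple x y z ∣       ≡⟨ ∣⁅x⁆∪p∣ x∉yz ⟩
  suc ∣ ⁅ y ⁆ ∪ ⁅ z ⁆ ∣  ≡⟨ cong suc (∣⁅x⁆∪p∣ (y≢z ∘ x∈⁅y⁆⇒x≡y z)) ⟩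
  2 + ∣ ⁅ z ⁆ ∣          ≡⟨ cong (2 +_) (∣⁅x⁆∣≡1 z) ⟩
  3                      ∎
  where
  open ≡-Reasoning
  x∉yz : x ∉ ⁅ y ⁆ ∪ ⁅ z ⁆
  x∉yz x∈ = [ x≢y ∘ x∈⁅y⁆⇒x≡y y , x≢z ∘ x∈⁅y⁆⇒x≡y z ]′ (x∈p∪q⁻ ⁅ y ⁆ ⁅ z ⁆ x∈)

triple-rotate : ∀ {x y z : Fin v} → triple x y z ≡ triple y z x
triple-rotate = ⊆-antisym (∈-triple⁺ ∘ left ∘ ∈-triple⁻) (∈-triple⁺ ∘ right ∘ ∈-triple⁻)
  where
  left : ∀ {A B C : Set} → A ⊎ B ⊎ C → B ⊎ C ⊎ A
  left (inj₁ a)        = inj₂ (inj₂ a)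
  left (inj₂ (inj₁ b)) = inj₁ b
  left (inj₂ (inj₂ c)) = inj₂ (inj₁ c)
  right : ∀ {A B C : Set} → B ⊎ C ⊎ A → A ⊎ B ⊎ C
  right (inj₁ b)        = inj₂ (inj₁ b)
  right (inj₂ (inj₁ c)) = inj₂ (inj₂ c)
  right (inj₂ (inj₂ a)) = inj₁ a

-- Kirkman triple systems given by permutations of order three.

-- A fixed-point-free permutation of order three is the same thing as an oriented
-- parallel class, its blocks being the orbits.
record KirkmanRotations (v r : ℕ) : Set where
  field
    σ       : Fin r → Fin v → Fin v
    σ-cubed : ∀ k x → σ k (σ k (σ k x)) ≡ x
    σ-moves : ∀ k x → σ k x ≢ x

  Joins : Fin r → Fin v → Fin v → Set
  Joins k x y = σ k x ≡ y ⊎ σ k (σ k x) ≡ y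

  field
    -- Only the uniqueness half of the pair condition is a field: that any two distinct points are
    -- joined at all follows from `size` by counting, in `joined`.
    joins-unique : ∀ {k l x y} → Joins k x y → Joins l x y → k ≡ l
    size         : v ≡ suc (r + r)

  σ-injective : ∀ k {x y} → σ k x ≡ σ k y → x ≡ y
  σ-injective k {x} {y} eq = begin
    x                  ≡⟨ σ-cubed k x ⟨
    σ k (σ k (σ k x))  ≡⟨ cong (σ k ∘ σ k) eq ⟩
    σ k (σ k (σ k y))  ≡⟨ σ-cubed k y ⟩
    y                  ∎
    where open ≡-Reasoning

  σ²-moves : ∀ k x → σ k (σ k x) ≢ x
  σ²-moves k x eq = σ-moves k x (trans (cong (σ k) (sym eq)) (σ-cubed k x))

  joins-≢ : ∀ {k x y} → Joins k x y → x ≢ y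
  joins-≢ (inj₁ eq) refl = σ-moves _ _ eq
  joins-≢ (inj₂ eq) refl = σ²-moves _ _ eq

  block : Fin r → Fin v → Subset v
  block k x = triple x (σ k x) (σ k (σ k x))

  system : Blocks v
  system B = ∃₂ λ k x → B ≡ block k x

  class : Fin r → Blocks v
  class k B = ∃ λ x → B ≡ block k x

  ∣block∣ : ∀ k x → ∣ block k x ∣ ≡ 3
  ∣block∣ k x = ∣triple∣ (σ-moves k x ∘ sym) (σ²-moves k x ∘ sym) (σ-moves k (σ k x) ∘ sym)

  ∈-block : ∀ k x → x ∈ block k x
  ∈-block k x = ∈-triple⁺ (inj₁ refl)

  block-σ : ∀ k x → block k x ≡ block k (σ k x)
  block-σ k x = trans triple-rotate (cong (triple (σ k x) (σ k (σ k x))) (sym (σ-cubed k x)))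

  block-cong : ∀ {k x y} → y ∈ block k x → block k x ≡ block k y
  block-cong y∈ with ∈-triple⁻ y∈
  ... | inj₁ refl        = refl
  ... | inj₂ (inj₁ refl) = block-σ _ _
  ... | inj₂ (inj₂ refl) = trans (block-σ _ _) (block-σ _ _)

  ∈-block⇒joins : ∀ {k x y} → x ≢ y → y ∈ block k x → Joins k x y
  ∈-block⇒joins x≢y y∈ with ∈-triple⁻ y∈
  ... | inj₁ eq        = contradiction (sym eq) x≢y
  ... | inj₂ (inj₁ eq) = inj₁ (sym eq)
  ... | inj₂ (inj₂ eq) = inj₂ (sym eq)

  joins⇒∈-block : ∀ {k x y} → Joins k x y → y ∈ block k x
  joins⇒∈-block (inj₁ eq) = ∈-triple⁺ (inj₂ (inj₁ (sym eq)))
  joins⇒∈-block (inj₂ eq) = ∈-triple⁺ (inj₂ (inj₂ (sym eq)))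

  neighbour : Fin v → Fin r ⊎ Fin r → Fin v
  neighbour x (inj₁ k) = σ k x
  neighbour x (inj₂ k) = σ k (σ k x)

  neighbour-joins : ∀ x s → ∃ λ k → Joins k x (neighbour x s)
  neighbour-joins x (inj₁ k) = k , inj₁ refl
  neighbour-joins x (inj₂ k) = k , inj₂ refl

  -- A coincidence between two neighbours forces their classes to agree by `joins-unique`; within
  -- one class it could only be a fixed point of `σ k`.
  neighbour-injective : ∀ x → Injective _≡_ _≡_ (neighbour x)
  neighbour-injective x {inj₁ k} {inj₁ l} eq = cong inj₁ (joins-unique (inj₁ eq) (inj₁ refl))
  neighbour-injective x {inj₂ k} {inj₂ l} eq = cong inj₂ (joins-unique (inj₂ eq) (inj₂ refl))
  neighbour-injective x {inj₁ k} {inj₂ l} eq with refl ← joins-unique (inj₁ eq) (inj₂ refl) =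
    contradiction (sym eq) (σ-moves k (σ k x))
  neighbour-injective x {inj₂ k} {inj₁ l} eq with refl ← joins-unique (inj₂ eq) (inj₁ refl) =
    contradiction eq (σ-moves k (σ k x))

  splitAt-injective : Injective _≡_ _≡_ (splitAt r {r})
  splitAt-injective {i} {j} eq with splitAt r i in i≡ | splitAt r j in j≡
  splitAt-injective refl | inj₁ _ | inj₁ _ = trans (sym (splitAt⁻¹-↑ˡ i≡)) (splitAt⁻¹-↑ˡ j≡)
  splitAt-injective refl | inj₂ _ | inj₂ _ = trans (sym (splitAt⁻¹-↑ʳ i≡)) (splitAt⁻¹-↑ʳ j≡)

  -- x, its 2 r neighbours and a further point would be 2 r + 2 points.
  joined : ∀ {x y} → x ≢ y → ∃ λ k → Joins k x y
  joined {x} {y} x≢y with any? (λ k → (σ k x ≟ y) ⊎-dec (σ k (σ k x) ≟ y))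
  ... | yes found = found
  ... | no missed = contradiction (subst (suc (suc (r + r)) Data.Nat.Base.≤_) size (injective⇒≤ points-injective)) 1+n≰n
    where
    points : Fin (suc (suc (r + r))) → Fin v
    points zero          = x
    points (suc zero)    = y
    points (suc (suc i)) = neighbour x (splitAt r i)
    x-new : ∀ i → x ≢ neighbour x (splitAt r i)
    x-new i = joins-≢ (proj₂ (neighbour-joins x (splitAt r i)))
    y-new : ∀ i → y ≢ neighbour x (splitAt r i)
    y-new i eq with k , joins ← neighbour-joins x (splitAt r i) = missed (k , subst (Joins k x) (sym eq) joins)
    points-injective : Injective _≡_ _≡_ points
    points-injective {zero}        {zero}        eq = refl
    points-injective {zero}        {suc zero}    eq = contradiction eq x≢y
    points-injective {zero}        {suc (suc j)} eq = contradiction eq (x-new j)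
    points-injective {suc zero}    {zero}        eq = contradiction (sym eq) x≢y
    points-injective {suc zero}    {suc zero}    eq = refl
    points-injective {suc zero}    {suc (suc j)} eq = contradiction eq (y-new j)
    points-injective {suc (suc i)} {zero}        eq = contradiction (sym eq) (x-new i)
    points-injective {suc (suc i)} {suc zero}    eq = contradiction (sym eq) (y-new i)
    points-injective {suc (suc i)} {suc (suc j)} eq =
      cong (λ i → suc (suc i)) (splitAt-injective (neighbour-injective x eq))

  isSTS : IsSTS system
  isSTS = record
    { triples = λ { (k , x , refl) → ∣block∣ k x }
    ; pairs   = λ {x} x≢y → let k , joins = joined x≢y in
        block k x , ((k , x , refl) , ∈-block k x , joins⇒∈-block joins) ,
        -- Any block through x can be rooted at x; as it also contains y, its class joins x to y, so
        -- the class is the one found above.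
        λ { ((l , z , refl) , x∈ , y∈) →
          let eq = block-cong x∈ in
          trans (cong (λ k → block k x)
                  (joins-unique joins (∈-block⇒joins x≢y (subst (_ ∈_) eq y∈))))
                (sym eq) }
    }

  isParallelClass : ∀ k → IsParallelClass system (class k)
  isParallelClass k = record
    { blocks    = λ { (x , eq) → k , x , eq }
    ; partition = λ x → block k x , ((x , refl) , ∈-block k x) ,
        λ { ((y , refl) , x∈) → sym (block-cong x∈) }
    }

  -- A block shared by two classes contains a pair of points that both classes join.
  class-unique : ∀ {B k l} → class k B → class l B → k ≡ l
  class-unique {k = k} {l} (x , refl) (y , eq) =
    joins-unique (inj₁ refl) (∈-block⇒joins (σ-moves k x ∘ sym) σx∈)
    where
    σx∈ : σ k x ∈ block l x
    σx∈ = subst (σ k x ∈_) (trans eq (block-cong (subst (x ∈_) eq (∈-block k x))))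
                (joins⇒∈-block (inj₁ refl))

  half : (v ∸ 1) / 2 ≡ r
  half = begin
    (v ∸ 1) / 2  ≡⟨ cong (λ w → (w ∸ 1) / 2) size ⟩
    (r + r) / 2  ≡⟨ cong (λ s → (r + s) / 2) (+-identityʳ r) ⟨
    2 * r / 2    ≡⟨ cong (_/ 2) (*-comm 2 r) ⟩
    r * 2 / 2    ≡⟨ m*n/n≡m r 2 ⟩
    r            ∎
    where open ≡-Reasoning

  resolution : Resolution system
  resolution = record
    { class         = class ∘ cast half
    ; parallelClass = isParallelClass ∘ cast half
    ; partition     = λ { {B} (k , x , eq) →
        cast (sym half) k ,
        subst (λ l → class l B) (sym (cast-involutive half (sym half) k)) (x , eq) ,
        λ B∈ → trans (cong (cast (sym half)) (class-unique (x , eq) B∈)) (cast-involutive (sym half) half _) }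
    }

-- Translates of one system and their disjointness.

-- Transport along the bijection `f`: the blocks of the result are the images under `f` of the
-- blocks of `R`. With a shift for `f` this is a translate.
conjugate : (R : KirkmanRotations v r) (f g : Fin v → Fin v) →
            (∀ x → f (g x) ≡ x) → (∀ x → g (f x) ≡ x) → KirkmanRotations v r
conjugate R f g fg gf = record
  { σ            = λ k x → f (σ k (g x))
  ; σ-cubed      = λ k x → trans
      (cong (f ∘ σ k) (trans (gf _) (cong (σ k) (gf _)))) (trans (cong f (σ-cubed k (g x))) (fg x))
  ; σ-moves      = λ k x eq → σ-moves k (g x) (trans (sym (gf _)) (cong g eq))
  ; joins-unique = λ p q → joins-unique (pull p) (pull q)
  ; size         = size
  }
  where
  open KirkmanRotations R
  pull : ∀ {k x y} → f (σ k (g x)) ≡ y ⊎ f (σ k (g (f (σ k (g x))))) ≡ y → Joins k (g x) (g y)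
  pull (inj₁ refl) = inj₁ (sym (gf _))
  pull (inj₂ refl) = inj₂ (sym (trans (gf _) (cong (σ _) (gf _))))

-- Blocks are unordered, so after removal of a common point the remaining two points agree only up
-- to a swap. This is why an anchor must be symmetric in the two differences.
triple-cancel : ∀ {x a b c d : Fin v} → x ≢ a → x ≢ b → a ≢ b → triple x a b ≡ triple x c d →
                (a ≡ c × b ≡ d) ⊎ (a ≡ d × b ≡ c)
triple-cancel x≢a x≢b a≢b eq
  with ∈-triple⁻ (subst (_ ∈_) eq (∈-triple⁺ (inj₂ (inj₁ refl))))
     | ∈-triple⁻ (subst (_ ∈_) eq (∈-triple⁺ (inj₂ (inj₂ refl))))
... | inj₁ a≡x        | _               = contradiction (sym a≡x) x≢a
... | _               | inj₁ b≡x        = contradiction (sym b≡x) x≢b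
... | inj₂ (inj₁ a≡c) | inj₂ (inj₂ b≡d) = inj₁ (a≡c , b≡d)
... | inj₂ (inj₂ a≡d) | inj₂ (inj₁ b≡c) = inj₂ (a≡d , b≡c)
... | inj₂ (inj₁ a≡c) | inj₂ (inj₁ b≡c) = contradiction (trans a≡c (sym b≡c)) a≢b
... | inj₂ (inj₂ a≡d) | inj₂ (inj₂ b≡d) = contradiction (trans a≡d (sym b≡d)) a≢b

-- Here shift s is addition of s and diff s is subtraction of s, both fixing the infinite
-- points.  A block B of the translate by s through a finite point p is known by its two
-- differences with p, from which anchor computes p - s.  So B and p determine s.
record Translates (R : KirkmanRotations v r) : Set₁ where
  open KirkmanRotations R
  field
    Finite      : Fin v → Set
    shift diff  : Fin (v ∸ 2) → Fin v → Fin v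
    shift-diff  : ∀ s x → shift s (diff s x) ≡ x
    diff-shift  : ∀ s x → diff s (shift s x) ≡ x
    difference  : Fin v → Fin v → ℕ
    anchor      : ℕ → ℕ → ℕ
    anchor-comm : ∀ d e → anchor d e ≡ anchor e d
    diff-finite : ∀ s {x} → Finite x → Finite (diff s x)
    diff-unique : ∀ {s t x} → Finite x → diff s x ≡ diff t x → s ≡ t
    difference-shift : ∀ s {p} x → Finite p → difference (shift s x) p ≡ difference x (diff s p)
    anchor-σ    : ∀ k {x} → Finite x →
                  anchor (difference (σ k x) x) (difference (σ k (σ k x)) x) ≡ toℕ x
    some-finite : ∀ {x y z} → x ≢ y → x ≢ z → y ≢ z → Finite x ⊎ Finite y ⊎ Finite z

  translate : Fin (v ∸ 2) → KirkmanRotations v r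
  translate s = conjugate R (shift s) (diff s) (shift-diff s) (diff-shift s)

  module T s = KirkmanRotations (translate s)

  -- The block of the translate through p is the shift of the base block through p - s. Its
  -- differences with p are those of the base block with p - s, and from these `anchor-σ` returns p
  -- - s.
  anchor-translate : ∀ s k {p} → Finite p →
    anchor (difference (T.σ s k p) p) (difference (T.σ s k (T.σ s k p)) p) ≡ toℕ (diff s p)
  anchor-translate s k {p} fin
    rewrite diff-shift s (σ k (diff s p))
          | difference-shift s (σ k (diff s p)) fin
          | difference-shift s (σ k (σ k (diff s p))) fin
    = anchor-σ k (diff-finite s fin)

  -- Anchors make sense only at finite points; by `some-finite` every block has one and can be
  -- rooted there.
  finite-point : ∀ {s k x} → ∃ λ p → Finite p × T.block s k x ≡ T.block s k p
  finite-point {s} {k} {x}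
    with some-finite (T.σ-moves s k x ∘ sym) (T.σ²-moves s k x ∘ sym) (T.σ-moves s k (T.σ s k x) ∘ sym)
  ... | inj₁ fin        = _ , fin , refl
  ... | inj₂ (inj₁ fin) = _ , fin , T.block-σ s k x
  ... | inj₂ (inj₂ fin) = _ , fin , trans (T.block-σ s k x) (T.block-σ s k (T.σ s k x))

  disjoint : ∀ {s t B} → T.system s B → T.system t B → s ≡ t
  disjoint {s} {t} (k , x , refl) (l , y , eq) with p , fin , eqₚ ← finite-point {s} {k} {x} =
    diff-unique fin (toℕ-injective (same (triple-cancel
      (T.σ-moves s k p ∘ sym) (T.σ²-moves s k p ∘ sym) (T.σ-moves s k (T.σ s k p) ∘ sym) rooted)))
    where
    rooted : T.block s k p ≡ T.block t l p
    rooted = trans (sym eqₚ) (trans eq (T.block-cong t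
      (subst (p ∈_) (trans (sym eqₚ) eq) (T.∈-block s k p))))
    same : (T.σ s k p ≡ T.σ t l p × T.σ s k (T.σ s k p) ≡ T.σ t l (T.σ t l p)) ⊎
           (T.σ s k p ≡ T.σ t l (T.σ t l p) × T.σ s k (T.σ s k p) ≡ T.σ t l p) →
           toℕ (diff s p) ≡ toℕ (diff t p)
    same (inj₁ (e , e²)) = trans (sym (anchor-translate s k fin)) (trans
      (cong₂ (λ a b → anchor (difference a p) (difference b p)) e e²)
      (anchor-translate t l fin))
    -- The two permutations may run through the common block in opposite directions; symmetry of the
    -- anchor absorbs this.
    same (inj₂ (e , e²)) = trans (sym (anchor-translate s k fin)) (trans
      (cong₂ (λ a b → anchor (difference a p) (difference b p)) e e²) (trans
      (anchor-comm (difference (T.σ t l (T.σ t l p)) p) (difference (T.σ t l p) p))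
      (anchor-translate t l fin)))

  largeSet : LKTS v
  largeSet = T.system
    , record
        { sts      = T.isSTS
        ; disjoint = λ i≢j (B∈i , B∈j) → i≢j (disjoint B∈i B∈j)
        }
    , T.resolution

-- Arithmetic modulo m.

module Residues (k : ℕ) where

  private m = suc k

  -- As `k` is -1 modulo `m`, the term `x + k * y` represents x - y without truncated subtraction.
  add sub : ℕ → ℕ → ℕ
  add x y = (x + y) % m
  sub x y = (x + k * y) % m

  add-< : ∀ x y → add x y < m
  add-< x y = m%n<n (x + y) m

  sub-< : ∀ x y → sub x y < m
  sub-< x y = m%n<n (x + k * y) m

  add-comm : ∀ x y → add x y ≡ add y x
  add-comm x y = cong (_% m) (+-comm x y)

  open ≡-Reasoning

  %-absorbˡ : ∀ x y → (x % m + y) % m ≡ (x + y) % m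
  %-absorbˡ x y = begin
    (x % m + y) % m          ≡⟨ %-distribˡ-+ (x % m) y m ⟩
    (x % m % m + y % m) % m  ≡⟨ cong (λ z → (z + y % m) % m) (m%n%n≡m%n x m) ⟩
    (x % m + y % m) % m      ≡⟨ %-distribˡ-+ x y m ⟨
    (x + y) % m              ∎

  %-absorbʳ : ∀ x c y → (x + c * (y % m)) % m ≡ (x + c * y) % m
  %-absorbʳ x c y = begin
    (x + c * (y % m)) % m                      ≡⟨ %-distribˡ-+ x _ m ⟩
    (x % m + c * (y % m) % m) % m              ≡⟨ cong (λ z → (x % m + z) % m) (%-distribˡ-* c _ m) ⟩
    (x % m + (c % m) * (y % m % m) % m) % m    ≡⟨ cong (λ z → (x % m + (c % m) * z % m) % m) (m%n%n≡m%n y m) ⟩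
    (x % m + (c % m) * (y % m) % m) % m        ≡⟨ cong (λ z → (x % m + z) % m) (%-distribˡ-* c y m) ⟨
    (x % m + c * y % m) % m                    ≡⟨ %-distribˡ-+ x _ m ⟨
    (x + c * y) % m                            ∎

  -- The multiples of `m` are explicit on both sides, so that each use reduces to an identity over
  -- ℕ, within reach of the ring solver.
  %-congruent : ∀ {x y} j k → x + j * m ≡ y + k * m → x % m ≡ y % m
  %-congruent {x} {y} j k eq = begin
    x % m            ≡⟨ [m+kn]%n≡m%n x j m ⟨
    (x + j * m) % m  ≡⟨ cong (_% m) eq ⟩
    (y + k * m) % m  ≡⟨ [m+kn]%n≡m%n y k m ⟩
    y % m            ∎

  sub-add : ∀ {x} s → x < m → sub (add s x) s ≡ x
  sub-add {x} s x<m = begin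
    sub (add s x) s      ≡⟨ %-absorbˡ (s + x) (k * s) ⟩
    (s + x + k * s) % m  ≡⟨ %-congruent 0 s (lemma s x k) ⟩
    x % m                ≡⟨ m<n⇒m%n≡m x<m ⟩
    x                    ∎
    where
    lemma : ∀ s x k → s + x + k * s + 0 ≡ x + s * suc k
    lemma = solve-∀

  add-sub : ∀ {x} s → x < m → add s (sub x s) ≡ x
  add-sub {x} s x<m = begin
    (s + sub x s) % m      ≡⟨ cong (_% m) (+-comm s _) ⟩
    (sub x s + s) % m      ≡⟨ %-absorbˡ (x + k * s) s ⟩
    (x + k * s + s) % m    ≡⟨ %-congruent 0 s (lemma s x k) ⟩
    x % m                  ≡⟨ m<n⇒m%n≡m x<m ⟩
    x                      ∎
    where
    lemma : ∀ s x k → x + k * s + s + 0 ≡ x + s * suc k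
    lemma = solve-∀

  -- The source of `difference-shift`: moving a point by s has the same effect on a difference as
  -- moving the reference point back by s.
  sub-sub : ∀ s x p → sub (add s x) p ≡ sub x (sub p s)
  sub-sub s x p = begin
    sub (add s x) p                ≡⟨ %-absorbˡ (s + x) (k * p) ⟩
    (s + x + k * p) % m            ≡⟨ %-congruent (k * s) s (lemma s x p k) ⟩
    (x + k * (p + k * s)) % m      ≡⟨ %-absorbʳ x k (p + k * s) ⟨
    sub x (sub p s)                ∎
    where
    lemma : ∀ s x p k → s + x + k * p + k * s * suc k ≡ x + k * (p + k * s) + s * suc k
    lemma = solve-∀

  -- Recovers the translation from p and p - s, which gives `diff-unique`.
  sub-involutive : ∀ {s} p → s < m → sub p (sub p s) ≡ s
  sub-involutive {s} p s<m = begin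
    sub p (sub p s)            ≡⟨ %-absorbʳ p k (p + k * s) ⟩
    (p + k * (p + k * s)) % m  ≡⟨ %-congruent s (p + k * s) (lemma s p k) ⟩
    s % m                      ≡⟨ m<n⇒m%n≡m s<m ⟩
    s                          ∎
    where
    lemma : ∀ s p k → p + k * (p + k * s) + s * suc k ≡ s + (p + k * s) * suc k
    lemma = solve-∀

-- The group ℤ/a × ℤ/b with two infinite points, on number codes.

-- The number i * b + j stands for the element (i , j) of ℤ/a × ℤ/b, where a = 1 + a-1 and
-- b = 1 + b-1; the two numbers n and 1 + n stand for the infinite points.
module Codes (a-1 b-1 : ℕ) where

  a b n order : ℕ
  a = suc a-1
  b = suc b-1
  n = a * b
  order = 2 + n

  hi lo : ℕ → ℕ
  hi x = x / b
  lo x = x % b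

  code : ℕ → ℕ → ℕ
  code i j = i * b + j

  module A = Residues a-1
  module B = Residues b-1

  add sub : ℕ → ℕ → ℕ
  add x y = code (A.add (hi x) (hi y)) (B.add (lo x) (lo y))
  sub x y = code (A.sub (hi x) (hi y)) (B.sub (lo x) (lo y))

  add-comm : ∀ x y → add x y ≡ add y x
  add-comm x y = cong₂ code (A.add-comm (hi x) (hi y)) (B.add-comm (lo x) (lo y))

  lo-code : ∀ i {j} → j < b → lo (code i j) ≡ j
  lo-code i {j} j<b = begin
    (i * b + j) % b  ≡⟨ cong (_% b) (+-comm (i * b) j) ⟩
    (j + i * b) % b  ≡⟨ [m+kn]%n≡m%n j i b ⟩
    j % b            ≡⟨ m<n⇒m%n≡m j<b ⟩
    j                ∎
    where open ≡-Reasoning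

  hi-code : ∀ i {j} → j < b → hi (code i j) ≡ i
  hi-code i {j} j<b = begin
    (i * b + j) / b    ≡⟨ +-distrib-/-∣ˡ j (divides-refl i) ⟩
    i * b / b + j / b  ≡⟨ cong₂ _+_ (m*n/n≡m i b) (m<n⇒m/n≡0 j<b) ⟩
    i + 0              ≡⟨ +-identityʳ i ⟩
    i                  ∎
    where open ≡-Reasoning

  code-hi-lo : ∀ x → code (hi x) (lo x) ≡ x
  code-hi-lo x = trans (+-comm (hi x * b) (lo x)) (sym (m≡m%n+[m/n]*n x b))

  code-< : ∀ {i j} → i < a → j < b → code i j < n
  code-< {i} i<a j<b = <-≤-trans (+-monoʳ-< (i * b) j<b)
    (subst (_≤ n) (+-comm b (i * b)) (*-monoˡ-≤ b i<a))

  hi-< : ∀ {x} → x < n → hi x < a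
  hi-< = m<n*o⇒m/o<n

  lo-< : ∀ x → lo x < b
  lo-< x = m%n<n x b

  add-< : ∀ x y → add x y < n
  add-< x y = code-< (A.add-< (hi x) (hi y)) (B.add-< (lo x) (lo y))

  sub-< : ∀ x y → sub x y < n
  sub-< x y = code-< (A.sub-< (hi x) (hi y)) (B.sub-< (lo x) (lo y))

  hi-add : ∀ x y → hi (add x y) ≡ A.add (hi x) (hi y)
  hi-add x y = hi-code (A.add (hi x) (hi y)) (B.add-< (lo x) (lo y))

  lo-add : ∀ x y → lo (add x y) ≡ B.add (lo x) (lo y)
  lo-add x y = lo-code (A.add (hi x) (hi y)) (B.add-< (lo x) (lo y))

  hi-sub : ∀ x y → hi (sub x y) ≡ A.sub (hi x) (hi y)
  hi-sub x y = hi-code (A.sub (hi x) (hi y)) (B.sub-< (lo x) (lo y))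

  lo-sub : ∀ x y → lo (sub x y) ≡ B.sub (lo x) (lo y)
  lo-sub x y = lo-code (A.sub (hi x) (hi y)) (B.sub-< (lo x) (lo y))

  sub-add : ∀ {x} s → x < n → sub (add s x) s ≡ x
  sub-add {x} s x<n rewrite hi-add s x | lo-add s x =
    trans (cong₂ code (A.sub-add (hi s) (hi-< x<n)) (B.sub-add (lo s) (lo-< x))) (code-hi-lo x)

  add-sub : ∀ {x} s → x < n → add s (sub x s) ≡ x
  add-sub {x} s x<n rewrite hi-sub x s | lo-sub x s =
    trans (cong₂ code (A.add-sub (hi s) (hi-< x<n)) (B.add-sub (lo s) (lo-< x))) (code-hi-lo x)

  sub-sub : ∀ s x p → sub (add s x) p ≡ sub x (sub p s)
  sub-sub s x p rewrite hi-add s x | lo-add s x | hi-sub p s | lo-sub p s =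
    cong₂ code (A.sub-sub (hi s) (hi x) (hi p)) (B.sub-sub (lo s) (lo x) (lo p))

  sub-involutive : ∀ {s} p → s < n → sub p (sub p s) ≡ s
  sub-involutive {s} p s<n rewrite hi-sub p s | lo-sub p s =
    trans (cong₂ code (A.sub-involutive (hi p) (hi-< s<n)) (B.sub-involutive (lo p) (lo-< s))) (code-hi-lo s)

  onFinite : (ℕ → ℕ) → ℕ → ℕ
  onFinite f x = if x <ᵇ n then f x else x

  shift diff : ℕ → ℕ → ℕ
  shift s x = onFinite (add s) x
  diff  x s = onFinite (λ y → sub y s) x

  onFinite-finite : ∀ f {x} → x < n → onFinite f x ≡ f x
  onFinite-finite f {x} x<n with x <ᵇ n | <⇒<ᵇ x<n
  ... | true | _ = refl

  onFinite-infinite : ∀ f {x} → ¬ x < n → onFinite f x ≡ x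
  onFinite-infinite f {x} x≮n with x <ᵇ n in eq
  ... | true  = contradiction (<ᵇ⇒< x n (subst T (sym eq) _)) x≮n
  ... | false = refl

  onFinite-< : ∀ f {x} → (∀ y → f y < n) → x < order → onFinite f x < order
  onFinite-< f {x} f< x<order with x <ᵇ n
  ... | true  = m≤n⇒m≤o+n 2 (f< x)
  ... | false = x<order

  onFinite-inverse : ∀ f g → (∀ y → g y < n) → (∀ {y} → y < n → f (g y) ≡ y) →
                     ∀ x → onFinite f (onFinite g x) ≡ x
  onFinite-inverse f g g< fg x with x <? n
  ... | yes x<n rewrite onFinite-finite g x<n = trans (onFinite-finite f (g< x)) (fg x<n)
  ... | no  x≮n rewrite onFinite-infinite g x≮n = onFinite-infinite f x≮n

  shift-diff : ∀ s x → shift s (diff x s) ≡ x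
  shift-diff s = onFinite-inverse (add s) (λ y → sub y s) (λ y → sub-< y s) (add-sub s)

  diff-shift : ∀ s x → diff (shift s x) s ≡ x
  diff-shift s = onFinite-inverse (λ y → sub y s) (add s) (add-< s) (sub-add s)

  diff-diff : ∀ s x {p} → p < n → diff (shift s x) p ≡ diff x (diff p s)
  diff-diff s x {p} p<n rewrite onFinite-finite (λ y → sub y s) p<n with x <? n
  ... | yes x<n rewrite onFinite-finite (add s) x<n
                      | onFinite-finite (λ y → sub y p) (add-< s x)
                      | onFinite-finite (λ y → sub y (sub p s)) x<n = sub-sub s x p
  ... | no  x≮n rewrite onFinite-infinite (add s) x≮n
                      | onFinite-infinite (λ y → sub y p) x≮n
                      | onFinite-infinite (λ y → sub y (sub p s)) x≮n = refl

  diff-finite : ∀ s {x} → x < n → diff x s < n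
  diff-finite s {x} x<n rewrite onFinite-finite (λ y → sub y s) x<n = sub-< x s

  diff-unique : ∀ {s t x} → s < n → t < n → x < n → diff x s ≡ diff x t → s ≡ t
  diff-unique {s} {t} {x} s<n t<n x<n eq
    rewrite onFinite-finite (λ y → sub y s) x<n | onFinite-finite (λ y → sub y t) x<n =
    trans (sym (sub-involutive x s<n)) (trans (cong (sub x) eq) (sub-involutive x t<n))

-- Lookup tables for fast evaluation.

-- The path to a key is its bijective base-4 expansion, so depth is logarithmic. Soundness below
-- rests on `find` being a function; a faulty `insert` could only make the check fail.
data Trie : Set where
  leaf : Trie
  node : Maybe ℕ → (t₀ t₁ t₂ t₃ : Trie) → Trie

find : ℕ → Trie → ℕ → ℕ
find d leaf                   _    = d
find d (node x _ _ _ _)       zero = fromMaybe d x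
find d (node _ t₀ t₁ t₂ t₃) (suc k) with k % 4
... | 0                 = find d t₀ (k / 4)
... | 1                 = find d t₁ (k / 4)
... | 2                 = find d t₂ (k / 4)
... | suc (suc (suc _)) = find d t₃ (k / 4)

insert : ℕ → ℕ → Trie → Trie
-- The key itself is enough fuel: a step takes `suc k` to `k / 4`, which is at most `k`. So the
-- clause of `put` with zero fuel and a nonzero key is never reached.
insert key x = go key key
  where
  go  : (fuel k : ℕ) → Trie → Trie
  put : (fuel k : ℕ) → Maybe ℕ → (t₀ t₁ t₂ t₃ : Trie) → Trie
  go fuel k leaf                 = put fuel k nothing leaf leaf leaf leaf
  go fuel k (node y t₀ t₁ t₂ t₃) = put fuel k y t₀ t₁ t₂ t₃
  put _          zero    _ t₀ t₁ t₂ t₃ = node (just x) t₀ t₁ t₂ t₃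
  put zero       (suc k) y t₀ t₁ t₂ t₃ = node y t₀ t₁ t₂ t₃
  put (suc fuel) (suc k) y t₀ t₁ t₂ t₃ with k % 4
  ... | 0                 = node y (go fuel (k / 4) t₀) t₁ t₂ t₃
  ... | 1                 = node y t₀ (go fuel (k / 4) t₁) t₂ t₃
  ... | 2                 = node y t₀ t₁ (go fuel (k / 4) t₂) t₃
  ... | suc (suc (suc _)) = node y t₀ t₁ t₂ (go fuel (k / 4) t₃)

-- Boolean checks over lists.

allIndexed : ∀ {A : Set} → (ℕ → A → Bool) → ℕ → List A → Bool
allIndexed p k []       = true
allIndexed p k (x ∷ xs) = p k x ∧ allIndexed p (suc k) xs

allIndexed-lookup : ∀ {A : Set} (p : ℕ → A → Bool) k xs → T (allIndexed p k xs) →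
                    ∀ i → T (p (k + toℕ i) (lookup xs i))
allIndexed-lookup p k (x ∷ xs) ok zero =
  subst (λ l → T (p l x)) (sym (+-identityʳ k)) (proj₁ (Equivalence.to T-∧ ok))
allIndexed-lookup p k (x ∷ xs) ok (suc i) =
  subst (λ l → T (p l (lookup xs i))) (sym (+-suc k (toℕ i)))
    (allIndexed-lookup p (suc k) xs (proj₂ (Equivalence.to (T-∧ {p k x}) ok)) i)

T-implies : ∀ {p q} → T (not p ∨ q) → T p → T q
T-implies {true} q _ = q

-- Being an argument of f, the value s x is evaluated once.
withOrbit : ∀ {A : Set} → (ℕ → ℕ) → ℕ → (ℕ → ℕ → A) → A
withOrbit s x f = go (s x)
  where
  go = λ y → f y (s y)

-- The evaluated check and its soundness.

-- zeroSum takes d + e to the point x for which x, x + d and x + e have sum zero; the anchors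
-- of the other blocks are looked up.
module Check (a-1 b-1 : ℕ) (zeroSum : ℕ → ℕ) where
  open Codes a-1 b-1

  -- As d e < order², the key determines the unordered pair of d and e.
  key : ℕ → ℕ → ℕ
  key d e = d * e + (d + e) * (order * order)

  anchor : Trie → ℕ → ℕ → ℕ
  anchor anchors d e = find (zeroSum (add d e)) anchors (key d e)

  anchor-comm : ∀ anchors d e → anchor anchors d e ≡ anchor anchors e d
  anchor-comm anchors d e = cong₂ (λ s k → find (zeroSum s) anchors k) (add-comm d e)
    (cong₂ (λ p s → p + s * (order * order)) (*-comm d e) (+-comm d e))

  exception : ℕ → ℕ → ℕ → Trie → Trie
  exception x y z t = if x <ᵇ n then go (diff y x) (diff z x) else t
    where
    go : ℕ → ℕ → Trie
    -- An entry is made only where the default value of the lookup in `anchor` would be wrong.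
    go d e = if zeroSum (add d e) ≡ᵇ x then t else insert (key d e) x t

  exceptions : List ℕ → List (ℕ → ℕ) → Trie
  exceptions points rows = foldr (λ x t → foldr (exceptionAt x) t rows) leaf points
    where
    exceptionAt : ℕ → (ℕ → ℕ) → Trie → Trie
    -- Each block is entered from all three of its points as root, so `points` has only to meet
    -- every irregular block.
    exceptionAt x s t = withOrbit s x λ y z → exception x y z (exception y z x (exception z x y t))

  -- The trie maps every point y other than x to the index of the class joining x and y.
  rowsAt : ℕ → ℕ → List (ℕ → ℕ) → Trie
  rowsAt x k []         = leaf
  rowsAt x k (s ∷ rows) = withOrbit s x λ y z → insert y k (insert z k (rowsAt x (suc k) rows))

  fits : Trie → ℕ → Trie → ℕ → (ℕ → ℕ) → Bool
  fits anchors x t k s = withOrbit s x λ y z →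
    (y <ᵇ order) ∧ not (y ≡ᵇ x) ∧ (s z ≡ᵇ x) ∧
    -- If two classes joined x to the same point, the lookup at that point could not return both
    -- indices; hence this test yields `joins-unique`.
    (find 0 t y ≡ᵇ k) ∧ (find 0 t z ≡ᵇ k) ∧
    (not (x <ᵇ n) ∨ (anchor anchors (diff y x) (diff z x) ≡ᵇ x))

  fitsAt : Trie → List (ℕ → ℕ) → ℕ → Bool
  fitsAt anchors rows x = allIndexed (fits anchors x (rowsAt x 0 rows)) 0 rows

  check : Trie → List (ℕ → ℕ) → Bool
  check anchors rows = all (fitsAt anchors rows) (upTo order)

  module _ (rows : List (ℕ → ℕ)) (anchors : Trie) (ok : T (check anchors rows))
           (size : order ≡ suc (length rows + length rows)) where

    row : Fin (length rows) → ℕ → ℕ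
    row = lookup rows

    record Fits (k : Fin (length rows)) (x : ℕ) : Set where
      field
        bounded : row k x < order
        moved   : row k x ≢ x
        cubed   : row k (row k (row k x)) ≡ x
        found₁  : find 0 (rowsAt x 0 rows) (row k x) ≡ toℕ k
        found₂  : find 0 (rowsAt x 0 rows) (row k (row k x)) ≡ toℕ k
        anchored : x < n → anchor anchors (diff (row k x) x) (diff (row k (row k x)) x) ≡ x

    fitted : ∀ k {x} → x < order → Fits k x
    fitted k {x} x<order
      with p₁ , q ← Equivalence.to T-∧ (allIndexed-lookup (fits anchors x (rowsAt x 0 rows)) 0 rows
                       (All.lookup (all⁺ (fitsAt anchors rows) (upTo order) ok) (∈-upTo⁺ x<order)) k)
      with p₂ , q ← Equivalence.to (T-∧ {not (row k x ≡ᵇ x)}) q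
      with p₃ , q ← Equivalence.to (T-∧ {row k (row k (row k x)) ≡ᵇ x}) q
      with p₄ , q ← Equivalence.to (T-∧ {find 0 (rowsAt x 0 rows) (row k x) ≡ᵇ toℕ k}) q
      with p₅ , p₆ ← Equivalence.to (T-∧ {find 0 (rowsAt x 0 rows) (row k (row k x)) ≡ᵇ toℕ k}) q
      = record
        { bounded  = <ᵇ⇒< _ _ p₁
        ; moved    = λ eq → subst T (Equivalence.to T-not-≡ p₂) (≡⇒≡ᵇ _ _ eq)
        ; cubed    = ≡ᵇ⇒≡ _ _ p₃
        ; found₁   = ≡ᵇ⇒≡ _ _ p₄
        ; found₂   = ≡ᵇ⇒≡ _ _ p₅
        ; anchored = λ x<n → ≡ᵇ⇒≡ _ _ (T-implies p₆ (<⇒<ᵇ x<n))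
        }

    σ : Fin (length rows) → Fin order → Fin order
    σ k x = fromℕ< (Fits.bounded (fitted k (toℕ<n x)))

    toℕ-σ : ∀ k x → toℕ (σ k x) ≡ row k (toℕ x)
    toℕ-σ k x = toℕ-fromℕ< _

    toℕ-σ² : ∀ k x → toℕ (σ k (σ k x)) ≡ row k (row k (toℕ x))
    toℕ-σ² k x = trans (toℕ-σ k (σ k x)) (cong (row k) (toℕ-σ k x))

    -- The table at x recovers the index of the class from the other point alone, which makes that
    -- class unique.
    found : ∀ {k x y} → σ k x ≡ y ⊎ σ k (σ k x) ≡ y →
            find 0 (rowsAt (toℕ x) 0 rows) (toℕ y) ≡ toℕ k
    found {k} {x} (inj₁ refl) = trans (cong (find 0 (rowsAt (toℕ x) 0 rows)) (toℕ-σ k x))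
      (Fits.found₁ (fitted k (toℕ<n x)))
    found {k} {x} (inj₂ refl) = trans (cong (find 0 (rowsAt (toℕ x) 0 rows)) (toℕ-σ² k x))
      (Fits.found₂ (fitted k (toℕ<n x)))

    rotations : KirkmanRotations order (length rows)
    rotations = record
      { σ            = σ
      ; σ-cubed      = λ k x → toℕ-injective (trans (toℕ-σ² k (σ k x))
          (trans (cong (row k ∘ row k) (toℕ-σ k x)) (Fits.cubed (fitted k (toℕ<n x)))))
      ; σ-moves      = λ k x eq → Fits.moved (fitted k (toℕ<n x)) (trans (sym (toℕ-σ k x)) (cong toℕ eq))
      ; joins-unique = λ p q → toℕ-injective (trans (sym (found p)) (found q))
      ; size         = size
      }

    liftFin : (f : ℕ → ℕ) → (∀ {x} → x < order → f x < order) → Fin order → Fin order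
    liftFin f f< x = fromℕ< (f< (toℕ<n x))

    toℕ-lift : ∀ f (f< : ∀ {x} → x < order → f x < order) x → toℕ (liftFin f f< x) ≡ f (toℕ x)
    toℕ-lift f f< x = toℕ-fromℕ< (f< (toℕ<n x))

    -- Pigeonhole: the only codes from `n` up to `order` are `n` and `suc n`.
    infinite-pair : ∀ {x y z} → x < order → y < order → z < order → ¬ x < n → ¬ y < n → ¬ z < n →
                    x ≡ y ⊎ x ≡ z ⊎ y ≡ z
    infinite-pair {x} {y} {z} x<order y<order z<order x≮n y≮n z≮n
      with infinite x<order x≮n | infinite y<order y≮n | infinite z<order z≮n
      where
      infinite : ∀ {w} → w < order → ¬ w < n → w ≡ n ⊎ w ≡ suc n
      infinite {w} w<order w≮n with m≤n⇒m<n∨m≡n (s≤s⁻¹ w<order)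
      ... | inj₂ w≡1+n = inj₂ w≡1+n
      ... | inj₁ w<1+n = inj₁ (≤-antisym (s≤s⁻¹ w<1+n) (≮⇒≥ w≮n))
    ... | inj₁ p | inj₁ q | _      = inj₁ (trans p (sym q))
    ... | inj₁ p | inj₂ _ | inj₁ q = inj₂ (inj₁ (trans p (sym q)))
    ... | inj₁ _ | inj₂ p | inj₂ q = inj₂ (inj₂ (trans p (sym q)))
    ... | inj₂ _ | inj₁ p | inj₁ q = inj₂ (inj₂ (trans p (sym q)))
    ... | inj₂ p | inj₁ _ | inj₂ q = inj₂ (inj₁ (trans p (sym q)))
    ... | inj₂ p | inj₂ q | _      = inj₁ (trans p (sym q))

    some-finite : ∀ {x y z : Fin order} → x ≢ y → x ≢ z → y ≢ z → toℕ x < n ⊎ toℕ y < n ⊎ toℕ z < n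
    some-finite {x} {y} {z} x≢y x≢z y≢z with toℕ x <? n | toℕ y <? n | toℕ z <? n
    ... | yes x<n | _       | _       = inj₁ x<n
    ... | no _    | yes y<n | _       = inj₂ (inj₁ y<n)
    ... | no _    | no _    | yes z<n = inj₂ (inj₂ z<n)
    ... | no x≮n  | no y≮n  | no z≮n
      with infinite-pair (toℕ<n x) (toℕ<n y) (toℕ<n z) x≮n y≮n z≮n
    ...   | inj₁ eq        = contradiction (toℕ-injective eq) x≢y
    ...   | inj₂ (inj₁ eq) = contradiction (toℕ-injective eq) x≢z
    ...   | inj₂ (inj₂ eq) = contradiction (toℕ-injective eq) y≢z

    -- As `order ∸ 2` reduces to `n`, the members of the large set are indexed by the elements of
    -- the group themselves.
    shiftBy diffBy : Fin n → Fin order → Fin order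
    shiftBy s = liftFin (shift (toℕ s)) (onFinite-< _ (add-< (toℕ s)))
    diffBy  s = liftFin (λ x → diff x (toℕ s)) (onFinite-< _ (λ y → sub-< y (toℕ s)))

    toℕ-shiftBy : ∀ s x → toℕ (shiftBy s x) ≡ shift (toℕ s) (toℕ x)
    toℕ-shiftBy s = toℕ-lift _ (onFinite-< _ (add-< (toℕ s)))

    toℕ-diffBy : ∀ s x → toℕ (diffBy s x) ≡ diff (toℕ x) (toℕ s)
    toℕ-diffBy s = toℕ-lift (λ x → diff x (toℕ s)) (onFinite-< _ (λ y → sub-< y (toℕ s)))

    translates : Translates rotations
    translates = record
      { Finite      = λ x → toℕ x < n
      ; shift       = shiftBy
      ; diff        = diffBy
      ; shift-diff  = λ s x → toℕ-injective (trans (toℕ-shiftBy s (diffBy s x))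
          (trans (cong (shift (toℕ s)) (toℕ-diffBy s x)) (shift-diff (toℕ s) (toℕ x))))
      ; diff-shift  = λ s x → toℕ-injective (trans (toℕ-diffBy s (shiftBy s x))
          (trans (cong (λ y → diff y (toℕ s)) (toℕ-shiftBy s x)) (diff-shift (toℕ s) (toℕ x))))
      ; difference  = λ x p → diff (toℕ x) (toℕ p)
      ; anchor      = anchor anchors
      ; anchor-comm = anchor-comm anchors
      ; diff-finite = λ s {x} x<n → subst (_< n) (sym (toℕ-diffBy s x)) (diff-finite (toℕ s) x<n)
      ; diff-unique = λ {s} {t} {x} x<n eq → toℕ-injective (diff-unique (toℕ<n s) (toℕ<n t) x<n
          (trans (sym (toℕ-diffBy s x)) (trans (cong toℕ eq) (toℕ-diffBy t x))))
      ; difference-shift = λ s {p} x p<n → trans (cong (λ y → diff y (toℕ p)) (toℕ-shiftBy s x))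
          (trans (diff-diff (toℕ s) (toℕ x) p<n) (cong (diff (toℕ x)) (sym (toℕ-diffBy s p))))
      ; anchor-σ    = λ k {x} x<n →
          subst₂ (λ y z → anchor anchors (diff y (toℕ x)) (diff z (toℕ x)) ≡ toℕ x)
            (sym (toℕ-σ k x)) (sym (toℕ-σ² k x)) (Fits.anchored (fitted k (toℕ<n x)) x<n)
      ; some-finite = some-finite
      }

    largeSet : LKTS order
    largeSet = Translates.largeSet translates

-- Base classes and their orbits under units.

module Rows (a-1 b-1 : ℕ) (_·_ : ℕ → ℕ → ℕ) (-⅓ : ℕ) where
  open Codes a-1 b-1

  -- A block that does not have sum zero contains an infinite point or lies in 0 × 𝔽_q, whose
  -- elements are encoded by the multiples of 7.
  irregularPoints : List ℕ
  irregularPoints = n ∷ suc n ∷ map (_* 7) (upTo (n / 7))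

  open Check a-1 b-1 (-⅓ ·_) public

  checked : List (ℕ → ℕ) → Bool
  checked rows = check (exceptions irregularPoints rows) rows

  -- A class is listed block after block; each three consecutive entries become one 3-cycle.
  rotation : List ℕ → Trie
  rotation (x ∷ y ∷ z ∷ blocks) = insert x y (insert y z (insert z x (rotation blocks)))
  rotation _                    = leaf

  -- The image of a class under multiplication by `u`, with both infinite points fixed. All units
  -- used below are squares modulo 7; a nonsquare would exchange the two kinds of blocks {∞ᵢ , x ,
  -- -2x}.
  conjugateBy : ℕ → ℕ → Trie → ℕ → ℕ
  conjugateBy u u⁻¹ t x = onFinite (u ·_) (find 0 t (onFinite (u⁻¹ ·_) x))

  -- A generator (g , g⁻¹ , k) contributes the powers of g with exponents below k. Here k may be
  -- less than the order of g, when the k-th power of g fixes the class. Without generators the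
  -- orbit is the class alone.
  orbit : List ℕ → List (ℕ × ℕ × ℕ) → List (ℕ → ℕ)
  orbit blocks generators = go (rotation blocks) generators 1 1
    where
    go : Trie → List (ℕ × ℕ × ℕ) → ℕ → ℕ → List (ℕ → ℕ)
    go t []                           u u⁻¹ = conjugateBy u u⁻¹ t ∷ []
    go t ((g , g⁻¹ , k) ∷ generators) u u⁻¹ = powers k u u⁻¹
      where
      powers : ℕ → ℕ → ℕ → List (ℕ → ℕ)
      powers zero    u u⁻¹ = []
      powers (suc k) u u⁻¹ = go t generators u u⁻¹ ++ powers k (g · u) (g⁻¹ · u⁻¹)

  largeSetFrom : ∀ rows → checked rows ≡ true → order ≡ suc (length rows + length rows) → LKTS order
  largeSetFrom rows ok = largeSet rows (exceptions irregularPoints rows) (Equivalence.from T-≡ ok)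

-- The rings ℤ/7 × 𝔽_q.

residueMul : ℕ → ℕ → ℕ → ℕ
residueMul n-1 u x = (u * x) % suc n-1

-- The ring ℤ/7 × 𝔽₂₅ is ℤ/35[X] / (5 X , X² - 7), as 7 is 0 modulo 7 and a nonsquare modulo 5.
quadraticMul : ℕ → ℕ → ℕ
quadraticMul u x = code ((hi u * lo x + hi x * lo u) % 5) ((lo u * lo x + 7 * (hi u * hi x)) % 35)
  where open Codes 4 34

-- For a prime q other than 7 the ring is ℤ/7q, so the first coordinate of a code lives in the
-- trivial group ℤ/1.
module CyclicRows (n-1 : ℕ) = Rows 0 n-1 (residueMul n-1)
module QuadraticRows = Rows 4 34 quadraticMul

-- The base classes for the five orders.

module Order93 where
  open CyclicRows 90 30

  -- The first five blocks are the class through {0 , ∞₁ , ∞₂} of the small Kirkman system on the 13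
  -- multiples of 7 and the infinite points 91 and 92.
  P₀ : List ℕ
  P₀ =
    0 ∷ 91 ∷ 92 ∷ 14 ∷ 56 ∷ 70 ∷ 28 ∷ 84 ∷ 63 ∷ 42 ∷ 7 ∷ 49 ∷ 21 ∷ 35 ∷ 77 ∷ 1 ∷ 9 ∷ 81 ∷
    15 ∷ 44 ∷ 32 ∷ 43 ∷ 23 ∷ 25 ∷ 8 ∷ 72 ∷ 11 ∷ 29 ∷ 79 ∷ 74 ∷ 71 ∷ 2 ∷ 18 ∷ 64 ∷ 30 ∷ 88 ∷
    50 ∷ 86 ∷ 46 ∷ 22 ∷ 16 ∷ 53 ∷ 57 ∷ 58 ∷ 67 ∷ 36 ∷ 51 ∷ 4 ∷ 85 ∷ 37 ∷ 60 ∷ 27 ∷ 61 ∷ 3 ∷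
    41 ∷ 5 ∷ 45 ∷ 69 ∷ 75 ∷ 38 ∷ 34 ∷ 33 ∷ 24 ∷ 55 ∷ 40 ∷ 87 ∷ 6 ∷ 54 ∷ 31 ∷ 90 ∷ 82 ∷ 10 ∷
    76 ∷ 47 ∷ 59 ∷ 48 ∷ 68 ∷ 66 ∷ 83 ∷ 19 ∷ 80 ∷ 62 ∷ 12 ∷ 17 ∷ 20 ∷ 89 ∷ 73 ∷ 78 ∷ 65 ∷ 39 ∷
    13 ∷ 26 ∷ 52 ∷ []

  -- The class is closed under negation, which exchanges 91 and 92 because -1 is a nonsquare modulo
  -- 7.
  Pᴬ : List ℕ
  Pᴬ =
    0 ∷ 1 ∷ 90 ∷ 15 ∷ 22 ∷ 54 ∷ 76 ∷ 69 ∷ 37 ∷ 28 ∷ 29 ∷ 34 ∷ 63 ∷ 62 ∷ 57 ∷ 50 ∷ 3 ∷ 38 ∷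
    41 ∷ 88 ∷ 53 ∷ 77 ∷ 45 ∷ 60 ∷ 14 ∷ 46 ∷ 31 ∷ 85 ∷ 30 ∷ 67 ∷ 6 ∷ 61 ∷ 24 ∷ 2 ∷ 16 ∷ 73 ∷
    89 ∷ 75 ∷ 18 ∷ 36 ∷ 66 ∷ 80 ∷ 55 ∷ 25 ∷ 11 ∷ 64 ∷ 17 ∷ 10 ∷ 27 ∷ 74 ∷ 81 ∷ 49 ∷ 51 ∷ 82 ∷
    42 ∷ 40 ∷ 9 ∷ 70 ∷ 44 ∷ 68 ∷ 21 ∷ 47 ∷ 23 ∷ 7 ∷ 79 ∷ 5 ∷ 84 ∷ 12 ∷ 86 ∷ 91 ∷ 4 ∷ 83 ∷
    92 ∷ 87 ∷ 8 ∷ 35 ∷ 43 ∷ 13 ∷ 56 ∷ 48 ∷ 78 ∷ 65 ∷ 58 ∷ 59 ∷ 26 ∷ 33 ∷ 32 ∷ 71 ∷ 72 ∷ 39 ∷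
    20 ∷ 19 ∷ 52 ∷ []

  Pᴮ : List ℕ
  Pᴮ =
    0 ∷ 78 ∷ 13 ∷ 91 ∷ 65 ∷ 52 ∷ 92 ∷ 26 ∷ 39 ∷ 14 ∷ 71 ∷ 6 ∷ 77 ∷ 85 ∷ 20 ∷ 56 ∷ 24 ∷ 11 ∷
    35 ∷ 80 ∷ 67 ∷ 42 ∷ 44 ∷ 5 ∷ 49 ∷ 86 ∷ 47 ∷ 28 ∷ 51 ∷ 12 ∷ 63 ∷ 79 ∷ 40 ∷ 70 ∷ 43 ∷ 69 ∷
    21 ∷ 22 ∷ 48 ∷ 84 ∷ 10 ∷ 88 ∷ 7 ∷ 3 ∷ 81 ∷ 1 ∷ 16 ∷ 74 ∷ 17 ∷ 75 ∷ 90 ∷ 29 ∷ 58 ∷ 4 ∷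
    87 ∷ 33 ∷ 62 ∷ 15 ∷ 30 ∷ 46 ∷ 45 ∷ 61 ∷ 76 ∷ 8 ∷ 23 ∷ 60 ∷ 31 ∷ 68 ∷ 83 ∷ 50 ∷ 9 ∷ 32 ∷
    59 ∷ 82 ∷ 41 ∷ 64 ∷ 2 ∷ 25 ∷ 66 ∷ 89 ∷ 27 ∷ 57 ∷ 72 ∷ 53 ∷ 38 ∷ 19 ∷ 34 ∷ 36 ∷ 37 ∷ 18 ∷
    73 ∷ 54 ∷ 55 ∷ []

  Pᶜ₁ : List ℕ
  Pᶜ₁ =
    0 ∷ 14 ∷ 35 ∷ 28 ∷ 56 ∷ 77 ∷ 70 ∷ 49 ∷ 63 ∷ 7 ∷ 21 ∷ 91 ∷ 42 ∷ 84 ∷ 92 ∷ 1 ∷ 2 ∷ 88 ∷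
    3 ∷ 89 ∷ 90 ∷ 64 ∷ 37 ∷ 81 ∷ 10 ∷ 54 ∷ 27 ∷ 8 ∷ 9 ∷ 74 ∷ 17 ∷ 82 ∷ 83 ∷ 57 ∷ 30 ∷ 4 ∷
    87 ∷ 61 ∷ 34 ∷ 22 ∷ 23 ∷ 46 ∷ 45 ∷ 68 ∷ 69 ∷ 43 ∷ 16 ∷ 32 ∷ 59 ∷ 75 ∷ 48 ∷ 29 ∷ 36 ∷ 26 ∷
    65 ∷ 55 ∷ 62 ∷ 15 ∷ 51 ∷ 25 ∷ 66 ∷ 40 ∷ 76 ∷ 71 ∷ 44 ∷ 67 ∷ 24 ∷ 47 ∷ 20 ∷ 85 ∷ 86 ∷ 11 ∷
    80 ∷ 5 ∷ 6 ∷ 50 ∷ 79 ∷ 53 ∷ 38 ∷ 12 ∷ 41 ∷ 58 ∷ 72 ∷ 52 ∷ 39 ∷ 19 ∷ 33 ∷ 78 ∷ 31 ∷ 73 ∷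
    18 ∷ 60 ∷ 13 ∷ []

  Pᶜ₂ : List ℕ
  Pᶜ₂ =
    0 ∷ 28 ∷ 7 ∷ 42 ∷ 56 ∷ 21 ∷ 70 ∷ 84 ∷ 77 ∷ 35 ∷ 63 ∷ 91 ∷ 14 ∷ 49 ∷ 92 ∷ 9 ∷ 18 ∷ 64 ∷
    27 ∷ 73 ∷ 82 ∷ 30 ∷ 60 ∷ 1 ∷ 90 ∷ 31 ∷ 61 ∷ 72 ∷ 81 ∷ 29 ∷ 62 ∷ 10 ∷ 19 ∷ 58 ∷ 88 ∷ 36 ∷
    55 ∷ 3 ∷ 33 ∷ 16 ∷ 25 ∷ 50 ∷ 41 ∷ 66 ∷ 75 ∷ 23 ∷ 53 ∷ 15 ∷ 76 ∷ 38 ∷ 68 ∷ 79 ∷ 51 ∷ 52 ∷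
    39 ∷ 40 ∷ 12 ∷ 44 ∷ 4 ∷ 43 ∷ 48 ∷ 87 ∷ 47 ∷ 2 ∷ 32 ∷ 57 ∷ 34 ∷ 59 ∷ 89 ∷ 37 ∷ 46 ∷ 8 ∷
    83 ∷ 45 ∷ 54 ∷ 86 ∷ 74 ∷ 22 ∷ 69 ∷ 17 ∷ 5 ∷ 67 ∷ 11 ∷ 13 ∷ 78 ∷ 80 ∷ 24 ∷ 65 ∷ 6 ∷ 20 ∷
    71 ∷ 85 ∷ 26 ∷ []

  Pᶜ₃ : List ℕ
  Pᶜ₃ =
    0 ∷ 42 ∷ 63 ∷ 14 ∷ 7 ∷ 77 ∷ 84 ∷ 21 ∷ 49 ∷ 28 ∷ 70 ∷ 91 ∷ 56 ∷ 35 ∷ 92 ∷ 81 ∷ 71 ∷ 30 ∷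
    61 ∷ 20 ∷ 10 ∷ 88 ∷ 85 ∷ 9 ∷ 82 ∷ 6 ∷ 3 ∷ 11 ∷ 1 ∷ 79 ∷ 12 ∷ 90 ∷ 80 ∷ 67 ∷ 64 ∷ 51 ∷
    40 ∷ 27 ∷ 24 ∷ 53 ∷ 43 ∷ 86 ∷ 5 ∷ 48 ∷ 38 ∷ 25 ∷ 22 ∷ 44 ∷ 47 ∷ 69 ∷ 66 ∷ 74 ∷ 4 ∷ 13 ∷
    78 ∷ 87 ∷ 17 ∷ 32 ∷ 36 ∷ 23 ∷ 68 ∷ 55 ∷ 59 ∷ 18 ∷ 15 ∷ 58 ∷ 33 ∷ 76 ∷ 73 ∷ 60 ∷ 50 ∷ 72 ∷
    19 ∷ 41 ∷ 31 ∷ 46 ∷ 29 ∷ 16 ∷ 75 ∷ 62 ∷ 45 ∷ 57 ∷ 8 ∷ 26 ∷ 65 ∷ 83 ∷ 34 ∷ 39 ∷ 54 ∷ 89 ∷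
    2 ∷ 37 ∷ 52 ∷ []

  Pᶜ₄ : List ℕ
  Pᶜ₄ =
    0 ∷ 56 ∷ 84 ∷ 14 ∷ 21 ∷ 63 ∷ 28 ∷ 35 ∷ 49 ∷ 42 ∷ 77 ∷ 91 ∷ 70 ∷ 7 ∷ 92 ∷ 1 ∷ 58 ∷ 32 ∷
    59 ∷ 33 ∷ 90 ∷ 71 ∷ 37 ∷ 74 ∷ 17 ∷ 54 ∷ 20 ∷ 15 ∷ 50 ∷ 26 ∷ 65 ∷ 41 ∷ 76 ∷ 8 ∷ 79 ∷ 4 ∷
    87 ∷ 12 ∷ 83 ∷ 29 ∷ 44 ∷ 18 ∷ 73 ∷ 47 ∷ 62 ∷ 64 ∷ 72 ∷ 46 ∷ 45 ∷ 19 ∷ 27 ∷ 43 ∷ 51 ∷ 88 ∷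
    3 ∷ 40 ∷ 48 ∷ 57 ∷ 23 ∷ 11 ∷ 80 ∷ 68 ∷ 34 ∷ 36 ∷ 86 ∷ 60 ∷ 31 ∷ 5 ∷ 55 ∷ 22 ∷ 2 ∷ 67 ∷
    24 ∷ 89 ∷ 69 ∷ 85 ∷ 16 ∷ 81 ∷ 10 ∷ 75 ∷ 6 ∷ 30 ∷ 9 ∷ 52 ∷ 39 ∷ 82 ∷ 61 ∷ 78 ∷ 66 ∷ 38 ∷
    53 ∷ 25 ∷ 13 ∷ []

  Pᶜ₅ : List ℕ
  Pᶜ₅ =
    0 ∷ 70 ∷ 21 ∷ 14 ∷ 28 ∷ 42 ∷ 84 ∷ 7 ∷ 35 ∷ 56 ∷ 49 ∷ 91 ∷ 63 ∷ 77 ∷ 92 ∷ 9 ∷ 67 ∷ 15 ∷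
    76 ∷ 24 ∷ 82 ∷ 2 ∷ 60 ∷ 29 ∷ 62 ∷ 31 ∷ 89 ∷ 44 ∷ 86 ∷ 52 ∷ 39 ∷ 5 ∷ 47 ∷ 72 ∷ 74 ∷ 36 ∷
    55 ∷ 17 ∷ 19 ∷ 79 ∷ 32 ∷ 71 ∷ 20 ∷ 59 ∷ 12 ∷ 30 ∷ 11 ∷ 50 ∷ 41 ∷ 80 ∷ 61 ∷ 23 ∷ 4 ∷ 64 ∷
    27 ∷ 87 ∷ 68 ∷ 58 ∷ 25 ∷ 8 ∷ 83 ∷ 66 ∷ 33 ∷ 51 ∷ 46 ∷ 85 ∷ 6 ∷ 45 ∷ 40 ∷ 16 ∷ 18 ∷ 57 ∷
    34 ∷ 73 ∷ 75 ∷ 37 ∷ 53 ∷ 1 ∷ 90 ∷ 38 ∷ 54 ∷ 88 ∷ 81 ∷ 13 ∷ 78 ∷ 10 ∷ 3 ∷ 65 ∷ 48 ∷ 69 ∷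
    22 ∷ 43 ∷ 26 ∷ []

  Pᶜ₆ : List ℕ
  Pᶜ₆ =
    0 ∷ 49 ∷ 77 ∷ 42 ∷ 70 ∷ 35 ∷ 56 ∷ 7 ∷ 63 ∷ 14 ∷ 84 ∷ 91 ∷ 28 ∷ 21 ∷ 92 ∷ 81 ∷ 57 ∷ 44 ∷
    47 ∷ 34 ∷ 10 ∷ 18 ∷ 85 ∷ 79 ∷ 12 ∷ 6 ∷ 73 ∷ 32 ∷ 46 ∷ 13 ∷ 78 ∷ 45 ∷ 59 ∷ 11 ∷ 29 ∷ 51 ∷
    40 ∷ 62 ∷ 80 ∷ 74 ∷ 15 ∷ 2 ∷ 89 ∷ 76 ∷ 17 ∷ 88 ∷ 8 ∷ 86 ∷ 5 ∷ 83 ∷ 3 ∷ 25 ∷ 36 ∷ 30 ∷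
    61 ∷ 55 ∷ 66 ∷ 67 ∷ 43 ∷ 72 ∷ 19 ∷ 48 ∷ 24 ∷ 4 ∷ 50 ∷ 37 ∷ 54 ∷ 41 ∷ 87 ∷ 53 ∷ 71 ∷ 58 ∷
    33 ∷ 20 ∷ 38 ∷ 60 ∷ 22 ∷ 9 ∷ 82 ∷ 69 ∷ 31 ∷ 64 ∷ 1 ∷ 26 ∷ 65 ∷ 90 ∷ 27 ∷ 39 ∷ 68 ∷ 75 ∷
    16 ∷ 23 ∷ 52 ∷ []

  rows : List (ℕ → ℕ)
  rows =
    orbit P₀ [] ++
    -- In ℤ/7 × 𝔽₁₃ the generators are (2 , 1) and (1 , 2), of orders 3 and 12. They generate the
    -- units that are squares modulo 7. As -1 is not among these, they permute the 36 blocks {0 , x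
    -- , -x} with x a unit regularly: one class for each such block.
    orbit Pᴬ ((79 , 53 , 3) ∷ (15 , 85 , 12) ∷ []) ++
    -- As 9 is 2 modulo 7, its powers carry {0 , x , -x} for x = (1 , 0) to the three blocks of this
    -- form in ℤ/7 × 0.
    orbit Pᴮ ((9 , 81 , 3) ∷ []) ++
    -- The remaining six classes of the small system on 15 points are extended one by one.
    orbit Pᶜ₁ [] ++
    orbit Pᶜ₂ [] ++
    orbit Pᶜ₃ [] ++
    orbit Pᶜ₄ [] ++
    orbit Pᶜ₅ [] ++
    orbit Pᶜ₆ []

  lkts : LKTS 93
  -- The first `refl` evaluates the whole check. The second counts 1 + 36 + 3 + 6 = 46 classes, and
  -- 93 = 1 + 46 + 46.
  lkts = largeSetFrom rows refl refl

module Order177 where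
  open QuadraticRows 23

  P₀ : List ℕ
  P₀ =
    0 ∷ 175 ∷ 176 ∷ 7 ∷ 49 ∷ 154 ∷ 28 ∷ 56 ∷ 161 ∷ 21 ∷ 77 ∷ 112 ∷ 14 ∷ 98 ∷ 133 ∷ 35 ∷ 91 ∷ 84 ∷
    126 ∷ 119 ∷ 140 ∷ 42 ∷ 63 ∷ 105 ∷ 70 ∷ 147 ∷ 168 ∷ 1 ∷ 107 ∷ 102 ∷ 57 ∷ 135 ∷ 53 ∷
    141 ∷ 51 ∷ 18 ∷ 155 ∷ 114 ∷ 116 ∷ 113 ∷ 9 ∷ 88 ∷ 162 ∷ 163 ∷ 95 ∷ 22 ∷ 44 ∷ 144 ∷
    99 ∷ 65 ∷ 81 ∷ 127 ∷ 72 ∷ 11 ∷ 120 ∷ 58 ∷ 67 ∷ 36 ∷ 23 ∷ 151 ∷ 134 ∷ 121 ∷ 165 ∷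
    29 ∷ 93 ∷ 123 ∷ 148 ∷ 100 ∷ 172 ∷ 64 ∷ 149 ∷ 32 ∷ 50 ∷ 86 ∷ 74 ∷ 92 ∷ 16 ∷ 137 ∷
    43 ∷ 37 ∷ 130 ∷ 8 ∷ 156 ∷ 46 ∷ 106 ∷ 170 ∷ 109 ∷ 78 ∷ 128 ∷ 4 ∷ 85 ∷ 142 ∷ 158 ∷ 169 ∷ 2 ∷ 39 ∷
    71 ∷ 79 ∷ 60 ∷ 6 ∷ 117 ∷ 87 ∷ 62 ∷ 110 ∷ 38 ∷ 146 ∷ 61 ∷ 3 ∷ 160 ∷ 124 ∷ 136 ∷ 118 ∷ 19 ∷ 73 ∷
    167 ∷ 173 ∷ 80 ∷ 27 ∷ 54 ∷ 164 ∷ 104 ∷ 40 ∷ 101 ∷ 132 ∷ 82 ∷ 31 ∷ 125 ∷ 68 ∷ 52 ∷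
    41 ∷ 33 ∷ 171 ∷ 139 ∷ 131 ∷ 150 ∷ 34 ∷ 103 ∷ 108 ∷ 153 ∷ 75 ∷ 157 ∷ 69 ∷ 159 ∷ 17 ∷
    55 ∷ 96 ∷ 94 ∷ 97 ∷ 26 ∷ 122 ∷ 48 ∷ 47 ∷ 115 ∷ 13 ∷ 166 ∷ 66 ∷ 111 ∷ 145 ∷ 129 ∷
    83 ∷ 138 ∷ 24 ∷ 90 ∷ 152 ∷ 143 ∷ 174 ∷ 12 ∷ 59 ∷ 76 ∷ 89 ∷ 45 ∷ 15 ∷ 30 ∷ 25 ∷ 20 ∷ 5 ∷ 10 ∷ []

  Pᴬ : List ℕ
  Pᴬ =
    0 ∷ 1 ∷ 34 ∷ 120 ∷ 155 ∷ 110 ∷ 90 ∷ 55 ∷ 100 ∷ 64 ∷ 86 ∷ 95 ∷ 146 ∷ 124 ∷ 115 ∷ 36 ∷ 43 ∷ 131 ∷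
    174 ∷ 167 ∷ 79 ∷ 148 ∷ 169 ∷ 103 ∷ 62 ∷ 41 ∷ 107 ∷ 8 ∷ 37 ∷ 165 ∷ 27 ∷ 173 ∷ 45 ∷
    92 ∷ 171 ∷ 157 ∷ 118 ∷ 39 ∷ 53 ∷ 50 ∷ 135 ∷ 60 ∷ 160 ∷ 75 ∷ 150 ∷ 127 ∷ 129 ∷ 164 ∷
    83 ∷ 81 ∷ 46 ∷ 162 ∷ 156 ∷ 102 ∷ 48 ∷ 54 ∷ 108 ∷ 2 ∷ 149 ∷ 59 ∷ 33 ∷ 61 ∷ 151 ∷ 85 ∷ 93 ∷ 67 ∷
    125 ∷ 117 ∷ 143 ∷ 134 ∷ 24 ∷ 87 ∷ 76 ∷ 11 ∷ 123 ∷ 44 ∷ 128 ∷ 38 ∷ 166 ∷ 82 ∷ 172 ∷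
    99 ∷ 141 ∷ 145 ∷ 111 ∷ 69 ∷ 65 ∷ 140 ∷ 106 ∷ 139 ∷ 35 ∷ 104 ∷ 71 ∷ 56 ∷ 57 ∷ 132 ∷
    154 ∷ 153 ∷ 78 ∷ 175 ∷ 113 ∷ 159 ∷ 176 ∷ 97 ∷ 51 ∷ 22 ∷ 23 ∷ 25 ∷ 13 ∷ 12 ∷ 10 ∷ 21 ∷ 29 ∷ 20 ∷
    14 ∷ 6 ∷ 15 ∷ 70 ∷ 66 ∷ 74 ∷ 105 ∷ 144 ∷ 136 ∷ 7 ∷ 170 ∷ 68 ∷ 28 ∷ 40 ∷ 142 ∷ 91 ∷ 17 ∷ 137 ∷
    119 ∷ 18 ∷ 73 ∷ 30 ∷ 114 ∷ 101 ∷ 5 ∷ 96 ∷ 109 ∷ 112 ∷ 9 ∷ 89 ∷ 98 ∷ 26 ∷ 121 ∷ 147 ∷ 16 ∷ 47 ∷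
    63 ∷ 19 ∷ 163 ∷ 161 ∷ 72 ∷ 152 ∷ 49 ∷ 138 ∷ 58 ∷ 42 ∷ 52 ∷ 116 ∷ 168 ∷ 158 ∷ 94 ∷
    126 ∷ 31 ∷ 88 ∷ 84 ∷ 4 ∷ 122 ∷ 77 ∷ 3 ∷ 130 ∷ 133 ∷ 32 ∷ 80 ∷ []

  Pᴮ : List ℕ
  Pᴮ =
    0 ∷ 15 ∷ 20 ∷ 175 ∷ 30 ∷ 10 ∷ 176 ∷ 5 ∷ 25 ∷ 50 ∷ 121 ∷ 39 ∷ 160 ∷ 89 ∷ 171 ∷ 18 ∷ 36 ∷ 156 ∷
    17 ∷ 174 ∷ 54 ∷ 8 ∷ 149 ∷ 53 ∷ 27 ∷ 61 ∷ 157 ∷ 95 ∷ 148 ∷ 142 ∷ 115 ∷ 62 ∷ 68 ∷ 85 ∷ 37 ∷ 88 ∷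
    125 ∷ 173 ∷ 122 ∷ 11 ∷ 92 ∷ 107 ∷ 24 ∷ 118 ∷ 103 ∷ 1 ∷ 128 ∷ 81 ∷ 34 ∷ 82 ∷ 129 ∷
    165 ∷ 106 ∷ 114 ∷ 45 ∷ 104 ∷ 96 ∷ 155 ∷ 79 ∷ 151 ∷ 55 ∷ 131 ∷ 59 ∷ 32 ∷ 169 ∷ 44 ∷
    3 ∷ 41 ∷ 166 ∷ 22 ∷ 51 ∷ 172 ∷ 13 ∷ 159 ∷ 38 ∷ 130 ∷ 57 ∷ 58 ∷ 80 ∷ 153 ∷ 152 ∷
    120 ∷ 163 ∷ 137 ∷ 90 ∷ 47 ∷ 73 ∷ 4 ∷ 113 ∷ 93 ∷ 31 ∷ 97 ∷ 117 ∷ 29 ∷ 72 ∷ 109 ∷ 6 ∷ 138 ∷ 101 ∷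
    60 ∷ 99 ∷ 86 ∷ 150 ∷ 111 ∷ 124 ∷ 141 ∷ 146 ∷ 98 ∷ 162 ∷ 167 ∷ 91 ∷ 127 ∷ 132 ∷ 161 ∷
    134 ∷ 139 ∷ 147 ∷ 64 ∷ 69 ∷ 112 ∷ 43 ∷ 48 ∷ 119 ∷ 78 ∷ 83 ∷ 49 ∷ 71 ∷ 76 ∷ 63 ∷ 16 ∷ 26 ∷ 28 ∷
    170 ∷ 145 ∷ 70 ∷ 2 ∷ 12 ∷ 21 ∷ 135 ∷ 110 ∷ 140 ∷ 9 ∷ 19 ∷ 7 ∷ 65 ∷ 40 ∷ 105 ∷ 23 ∷ 33 ∷ 14 ∷
    100 ∷ 75 ∷ 35 ∷ 67 ∷ 52 ∷ 126 ∷ 123 ∷ 108 ∷ 154 ∷ 74 ∷ 94 ∷ 42 ∷ 46 ∷ 66 ∷ 133 ∷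
    158 ∷ 143 ∷ 84 ∷ 102 ∷ 87 ∷ 56 ∷ 116 ∷ 136 ∷ 168 ∷ 144 ∷ 164 ∷ 77 ∷ []

  Pᶜ₁ : List ℕ
  Pᶜ₁ =
    0 ∷ 7 ∷ 28 ∷ 21 ∷ 147 ∷ 175 ∷ 14 ∷ 63 ∷ 176 ∷ 35 ∷ 56 ∷ 119 ∷ 91 ∷ 140 ∷ 154 ∷ 49 ∷ 105 ∷ 112 ∷
    70 ∷ 98 ∷ 161 ∷ 42 ∷ 84 ∷ 133 ∷ 77 ∷ 126 ∷ 168 ∷ 44 ∷ 156 ∷ 10 ∷ 25 ∷ 54 ∷ 166 ∷
    64 ∷ 23 ∷ 158 ∷ 141 ∷ 2 ∷ 67 ∷ 52 ∷ 12 ∷ 146 ∷ 143 ∷ 33 ∷ 69 ∷ 22 ∷ 37 ∷ 151 ∷ 8 ∷ 163 ∷ 39 ∷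
    59 ∷ 173 ∷ 13 ∷ 171 ∷ 47 ∷ 27 ∷ 15 ∷ 17 ∷ 3 ∷ 32 ∷ 18 ∷ 20 ∷ 57 ∷ 148 ∷ 5 ∷ 30 ∷ 62 ∷ 153 ∷
    1 ∷ 71 ∷ 138 ∷ 29 ∷ 134 ∷ 82 ∷ 92 ∷ 24 ∷ 129 ∷ 113 ∷ 31 ∷ 101 ∷ 16 ∷ 86 ∷ 108 ∷ 9 ∷ 114 ∷ 87 ∷
    72 ∷ 34 ∷ 139 ∷ 128 ∷ 6 ∷ 76 ∷ 11 ∷ 81 ∷ 118 ∷ 4 ∷ 109 ∷ 97 ∷ 102 ∷ 19 ∷ 124 ∷ 123 ∷ 26 ∷ 96 ∷
    50 ∷ 43 ∷ 117 ∷ 78 ∷ 150 ∷ 157 ∷ 127 ∷ 45 ∷ 38 ∷ 155 ∷ 162 ∷ 103 ∷ 65 ∷ 58 ∷ 122 ∷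
    93 ∷ 160 ∷ 167 ∷ 107 ∷ 55 ∷ 48 ∷ 170 ∷ 142 ∷ 73 ∷ 60 ∷ 53 ∷ 132 ∷ 88 ∷ 145 ∷ 152 ∷
    137 ∷ 40 ∷ 68 ∷ 165 ∷ 172 ∷ 83 ∷ 36 ∷ 100 ∷ 74 ∷ 85 ∷ 79 ∷ 46 ∷ 99 ∷ 51 ∷ 95 ∷
    120 ∷ 121 ∷ 144 ∷ 106 ∷ 149 ∷ 130 ∷ 169 ∷ 135 ∷ 116 ∷ 66 ∷ 89 ∷ 90 ∷ 80 ∷ 61 ∷ 104 ∷
    94 ∷ 75 ∷ 41 ∷ 115 ∷ 159 ∷ 111 ∷ 136 ∷ 110 ∷ 174 ∷ 164 ∷ 131 ∷ 125 ∷ []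

  Pᶜ₂ : List ℕ
  Pᶜ₂ =
    0 ∷ 91 ∷ 119 ∷ 21 ∷ 84 ∷ 105 ∷ 14 ∷ 70 ∷ 126 ∷ 35 ∷ 154 ∷ 176 ∷ 56 ∷ 140 ∷ 175 ∷
    42 ∷ 49 ∷ 147 ∷ 63 ∷ 161 ∷ 168 ∷ 7 ∷ 77 ∷ 98 ∷ 28 ∷ 112 ∷ 133 ∷ 50 ∷ 155 ∷ 5 ∷ 30 ∷ 55 ∷ 160 ∷
    60 ∷ 106 ∷ 44 ∷ 165 ∷ 99 ∷ 156 ∷ 166 ∷ 104 ∷ 150 ∷ 54 ∷ 111 ∷ 45 ∷ 74 ∷ 141 ∷ 170 ∷
    116 ∷ 64 ∷ 65 ∷ 40 ∷ 69 ∷ 136 ∷ 145 ∷ 146 ∷ 94 ∷ 25 ∷ 89 ∷ 131 ∷ 79 ∷ 121 ∷ 10 ∷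
    151 ∷ 39 ∷ 20 ∷ 15 ∷ 171 ∷ 59 ∷ 67 ∷ 11 ∷ 167 ∷ 158 ∷ 4 ∷ 48 ∷ 53 ∷ 173 ∷ 19 ∷ 172 ∷ 47 ∷ 26 ∷
    57 ∷ 1 ∷ 152 ∷ 148 ∷ 29 ∷ 68 ∷ 43 ∷ 143 ∷ 24 ∷ 162 ∷ 52 ∷ 31 ∷ 37 ∷ 16 ∷ 157 ∷ 163 ∷ 9 ∷ 38 ∷
    58 ∷ 153 ∷ 34 ∷ 142 ∷ 62 ∷ 6 ∷ 102 ∷ 18 ∷ 125 ∷ 95 ∷ 138 ∷ 12 ∷ 130 ∷ 82 ∷ 33 ∷ 123 ∷ 32 ∷ 90 ∷
    92 ∷ 8 ∷ 110 ∷ 85 ∷ 108 ∷ 17 ∷ 120 ∷ 87 ∷ 3 ∷ 113 ∷ 22 ∷ 75 ∷ 72 ∷ 23 ∷ 115 ∷ 100 ∷ 118 ∷ 27 ∷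
    135 ∷ 97 ∷ 13 ∷ 128 ∷ 2 ∷ 80 ∷ 109 ∷ 169 ∷ 107 ∷ 144 ∷ 127 ∷ 114 ∷ 137 ∷ 134 ∷ 149 ∷
    46 ∷ 78 ∷ 86 ∷ 88 ∷ 71 ∷ 51 ∷ 81 ∷ 36 ∷ 93 ∷ 124 ∷ 132 ∷ 164 ∷ 159 ∷ 139 ∷ 122 ∷
    117 ∷ 174 ∷ 129 ∷ 61 ∷ 76 ∷ 73 ∷ 103 ∷ 41 ∷ 101 ∷ 96 ∷ 83 ∷ 66 ∷ []

  Pᶜ₃ : List ℕ
  Pᶜ₃ =
    0 ∷ 77 ∷ 133 ∷ 21 ∷ 28 ∷ 35 ∷ 7 ∷ 14 ∷ 140 ∷ 42 ∷ 126 ∷ 112 ∷ 98 ∷ 84 ∷ 168 ∷ 56 ∷ 91 ∷ 105 ∷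
    70 ∷ 119 ∷ 154 ∷ 63 ∷ 49 ∷ 175 ∷ 161 ∷ 147 ∷ 176 ∷ 102 ∷ 123 ∷ 20 ∷ 15 ∷ 87 ∷ 108 ∷
    72 ∷ 88 ∷ 50 ∷ 128 ∷ 137 ∷ 155 ∷ 160 ∷ 122 ∷ 138 ∷ 55 ∷ 73 ∷ 82 ∷ 107 ∷ 165 ∷ 113 ∷
    93 ∷ 60 ∷ 92 ∷ 97 ∷ 45 ∷ 103 ∷ 118 ∷ 150 ∷ 117 ∷ 30 ∷ 132 ∷ 83 ∷ 127 ∷ 78 ∷ 5 ∷ 170 ∷ 65 ∷ 10 ∷
    25 ∷ 145 ∷ 40 ∷ 156 ∷ 37 ∷ 17 ∷ 44 ∷ 163 ∷ 3 ∷ 23 ∷ 69 ∷ 153 ∷ 2 ∷ 146 ∷ 62 ∷ 151 ∷ 67 ∷ 27 ∷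
    39 ∷ 158 ∷ 13 ∷ 18 ∷ 54 ∷ 173 ∷ 32 ∷ 166 ∷ 47 ∷ 141 ∷ 57 ∷ 12 ∷ 64 ∷ 148 ∷ 33 ∷ 8 ∷ 59 ∷ 143 ∷
    22 ∷ 171 ∷ 52 ∷ 58 ∷ 121 ∷ 66 ∷ 149 ∷ 167 ∷ 104 ∷ 51 ∷ 48 ∷ 111 ∷ 142 ∷ 79 ∷ 164 ∷
    53 ∷ 116 ∷ 41 ∷ 144 ∷ 152 ∷ 89 ∷ 46 ∷ 68 ∷ 131 ∷ 172 ∷ 74 ∷ 174 ∷ 43 ∷ 106 ∷ 61 ∷
    169 ∷ 157 ∷ 94 ∷ 36 ∷ 38 ∷ 136 ∷ 162 ∷ 99 ∷ 159 ∷ 9 ∷ 81 ∷ 120 ∷ 86 ∷ 130 ∷ 29 ∷ 135 ∷ 4 ∷ 71 ∷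
    114 ∷ 95 ∷ 1 ∷ 100 ∷ 11 ∷ 134 ∷ 16 ∷ 109 ∷ 85 ∷ 34 ∷ 115 ∷ 96 ∷ 76 ∷ 24 ∷ 110 ∷
    125 ∷ 101 ∷ 19 ∷ 139 ∷ 31 ∷ 75 ∷ 90 ∷ 129 ∷ 26 ∷ 6 ∷ 80 ∷ 124 ∷ []

  Pᶜ₄ : List ℕ
  Pᶜ₄ =
    0 ∷ 63 ∷ 147 ∷ 7 ∷ 35 ∷ 168 ∷ 28 ∷ 42 ∷ 140 ∷ 21 ∷ 161 ∷ 154 ∷ 14 ∷ 56 ∷ 49 ∷ 70 ∷ 84 ∷ 112 ∷
    98 ∷ 105 ∷ 126 ∷ 91 ∷ 133 ∷ 175 ∷ 77 ∷ 119 ∷ 176 ∷ 58 ∷ 142 ∷ 10 ∷ 25 ∷ 68 ∷ 152 ∷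
    43 ∷ 100 ∷ 102 ∷ 162 ∷ 135 ∷ 123 ∷ 108 ∷ 110 ∷ 167 ∷ 87 ∷ 75 ∷ 48 ∷ 120 ∷ 128 ∷ 172 ∷
    85 ∷ 72 ∷ 53 ∷ 38 ∷ 82 ∷ 90 ∷ 157 ∷ 138 ∷ 125 ∷ 15 ∷ 115 ∷ 80 ∷ 130 ∷ 95 ∷ 20 ∷ 113 ∷ 92 ∷ 5 ∷
    30 ∷ 118 ∷ 97 ∷ 155 ∷ 141 ∷ 89 ∷ 50 ∷ 64 ∷ 131 ∷ 106 ∷ 45 ∷ 59 ∷ 99 ∷ 150 ∷ 171 ∷
    170 ∷ 156 ∷ 94 ∷ 65 ∷ 44 ∷ 136 ∷ 121 ∷ 55 ∷ 69 ∷ 79 ∷ 160 ∷ 146 ∷ 165 ∷ 151 ∷ 104 ∷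
    60 ∷ 39 ∷ 111 ∷ 116 ∷ 40 ∷ 54 ∷ 74 ∷ 145 ∷ 166 ∷ 8 ∷ 78 ∷ 124 ∷ 71 ∷ 17 ∷ 122 ∷ 134 ∷ 3 ∷ 73 ∷
    22 ∷ 127 ∷ 96 ∷ 23 ∷ 93 ∷ 129 ∷ 86 ∷ 27 ∷ 132 ∷ 114 ∷ 13 ∷ 83 ∷ 2 ∷ 107 ∷ 101 ∷ 18 ∷ 88 ∷ 139 ∷
    81 ∷ 12 ∷ 117 ∷ 109 ∷ 33 ∷ 103 ∷ 32 ∷ 137 ∷ 76 ∷ 148 ∷ 16 ∷ 46 ∷ 1 ∷ 51 ∷ 158 ∷ 36 ∷ 163 ∷ 11 ∷
    29 ∷ 149 ∷ 67 ∷ 169 ∷ 37 ∷ 4 ∷ 57 ∷ 9 ∷ 144 ∷ 143 ∷ 61 ∷ 6 ∷ 31 ∷ 173 ∷ 41 ∷ 66 ∷ 26 ∷ 153 ∷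
    24 ∷ 47 ∷ 174 ∷ 164 ∷ 19 ∷ 62 ∷ 52 ∷ 159 ∷ 34 ∷ []

  rows : List (ℕ → ℕ)
  rows =
    orbit P₀ [] ++
    -- Here 16 is (2 , 1), and 57 is (1 , 2 + X) with 2 + X a generator of the units of 𝔽₂₅.
    orbit Pᴬ ((16 , 11 , 3) ∷ (57 , 71 , 24) ∷ []) ++
    -- 156 is (2 , 1 + 4X), of order 12; its cube (1 , 2) fixes the class, so three powers exhaust
    -- the orbit.
    orbit Pᴮ ((156 , 144 , 3) ∷ []) ++
    -- 107 is (2 , 2 + 3X), of order 3, so four base classes account for the twelve remaining
    -- classes of the small system on 27 points.
    orbit Pᶜ₁ ((107 , 102 , 3) ∷ []) ++
    orbit Pᶜ₂ ((107 , 102 , 3) ∷ []) ++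
    orbit Pᶜ₃ ((107 , 102 , 3) ∷ []) ++
    orbit Pᶜ₄ ((107 , 102 , 3) ∷ [])

  lkts : LKTS 177
  lkts = largeSetFrom rows refl refl

module Order219 where
  open CyclicRows 216 72

  P₀ : List ℕ
  P₀ =
    0 ∷ 217 ∷ 218 ∷ 63 ∷ 98 ∷ 56 ∷ 126 ∷ 196 ∷ 112 ∷ 189 ∷ 168 ∷ 77 ∷ 35 ∷ 7 ∷ 175 ∷
    161 ∷ 119 ∷ 154 ∷ 70 ∷ 133 ∷ 14 ∷ 42 ∷ 210 ∷ 182 ∷ 105 ∷ 21 ∷ 91 ∷ 140 ∷ 49 ∷ 28 ∷
    203 ∷ 84 ∷ 147 ∷ 1 ∷ 149 ∷ 67 ∷ 127 ∷ 44 ∷ 46 ∷ 71 ∷ 163 ∷ 200 ∷ 120 ∷ 86 ∷ 11 ∷ 50 ∷ 72 ∷ 95 ∷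
    57 ∷ 30 ∷ 130 ∷ 78 ∷ 121 ∷ 18 ∷ 141 ∷ 177 ∷ 116 ∷ 113 ∷ 128 ∷ 193 ∷ 29 ∷ 198 ∷ 207 ∷
    211 ∷ 191 ∷ 32 ∷ 106 ∷ 170 ∷ 158 ∷ 8 ∷ 107 ∷ 102 ∷ 148 ∷ 135 ∷ 151 ∷ 134 ∷ 2 ∷ 81 ∷
    92 ∷ 37 ∷ 88 ∷ 183 ∷ 142 ∷ 109 ∷ 22 ∷ 23 ∷ 172 ∷ 190 ∷ 100 ∷ 144 ∷ 43 ∷ 114 ∷ 60 ∷
    36 ∷ 156 ∷ 25 ∷ 15 ∷ 65 ∷ 137 ∷ 169 ∷ 9 ∷ 39 ∷ 197 ∷ 58 ∷ 179 ∷ 64 ∷ 205 ∷ 165 ∷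
    99 ∷ 212 ∷ 123 ∷ 204 ∷ 16 ∷ 214 ∷ 85 ∷ 79 ∷ 53 ∷ 162 ∷ 51 ∷ 4 ∷ 176 ∷ 184 ∷ 74 ∷
    125 ∷ 180 ∷ 129 ∷ 34 ∷ 75 ∷ 108 ∷ 195 ∷ 194 ∷ 45 ∷ 27 ∷ 117 ∷ 73 ∷ 174 ∷ 103 ∷ 157 ∷
    181 ∷ 61 ∷ 192 ∷ 202 ∷ 152 ∷ 80 ∷ 48 ∷ 208 ∷ 178 ∷ 20 ∷ 159 ∷ 38 ∷ 153 ∷ 12 ∷ 52 ∷
    118 ∷ 5 ∷ 94 ∷ 13 ∷ 201 ∷ 3 ∷ 132 ∷ 138 ∷ 164 ∷ 55 ∷ 166 ∷ 213 ∷ 41 ∷ 33 ∷ 143 ∷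
    216 ∷ 68 ∷ 150 ∷ 90 ∷ 173 ∷ 171 ∷ 146 ∷ 54 ∷ 17 ∷ 97 ∷ 131 ∷ 206 ∷ 167 ∷ 145 ∷ 122 ∷
    160 ∷ 187 ∷ 87 ∷ 139 ∷ 96 ∷ 199 ∷ 76 ∷ 40 ∷ 101 ∷ 104 ∷ 89 ∷ 24 ∷ 188 ∷ 19 ∷ 10 ∷
    6 ∷ 26 ∷ 185 ∷ 111 ∷ 47 ∷ 59 ∷ 209 ∷ 110 ∷ 115 ∷ 69 ∷ 82 ∷ 66 ∷ 83 ∷ 215 ∷ 136 ∷
    155 ∷ 93 ∷ 186 ∷ 62 ∷ 124 ∷ 31 ∷ []

  Pᴬ : List ℕ
  Pᴬ =
    0 ∷ 1 ∷ 216 ∷ 70 ∷ 127 ∷ 20 ∷ 147 ∷ 90 ∷ 197 ∷ 154 ∷ 29 ∷ 34 ∷ 63 ∷ 188 ∷ 183 ∷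
    175 ∷ 149 ∷ 110 ∷ 42 ∷ 68 ∷ 107 ∷ 196 ∷ 9 ∷ 12 ∷ 21 ∷ 208 ∷ 205 ∷ 126 ∷ 50 ∷ 41 ∷
    91 ∷ 167 ∷ 176 ∷ 119 ∷ 71 ∷ 27 ∷ 98 ∷ 146 ∷ 190 ∷ 28 ∷ 94 ∷ 95 ∷ 189 ∷ 123 ∷ 122 ∷
    84 ∷ 143 ∷ 207 ∷ 133 ∷ 74 ∷ 10 ∷ 182 ∷ 87 ∷ 165 ∷ 35 ∷ 130 ∷ 52 ∷ 168 ∷ 92 ∷ 174 ∷
    49 ∷ 125 ∷ 43 ∷ 105 ∷ 72 ∷ 40 ∷ 112 ∷ 145 ∷ 177 ∷ 77 ∷ 178 ∷ 179 ∷ 140 ∷ 39 ∷ 38 ∷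
    56 ∷ 86 ∷ 75 ∷ 161 ∷ 131 ∷ 142 ∷ 7 ∷ 17 ∷ 193 ∷ 210 ∷ 200 ∷ 24 ∷ 14 ∷ 141 ∷ 62 ∷
    203 ∷ 76 ∷ 155 ∷ 36 ∷ 79 ∷ 102 ∷ 181 ∷ 138 ∷ 115 ∷ 217 ∷ 214 ∷ 6 ∷ 218 ∷ 3 ∷ 211 ∷
    128 ∷ 44 ∷ 45 ∷ 89 ∷ 173 ∷ 172 ∷ 64 ∷ 2 ∷ 151 ∷ 153 ∷ 215 ∷ 66 ∷ 169 ∷ 192 ∷ 73 ∷
    48 ∷ 25 ∷ 144 ∷ 204 ∷ 114 ∷ 116 ∷ 13 ∷ 103 ∷ 101 ∷ 37 ∷ 198 ∷ 199 ∷ 180 ∷ 19 ∷ 18 ∷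
    51 ∷ 58 ∷ 108 ∷ 166 ∷ 159 ∷ 109 ∷ 120 ∷ 164 ∷ 150 ∷ 97 ∷ 53 ∷ 67 ∷ 156 ∷ 65 ∷ 213 ∷
    61 ∷ 152 ∷ 4 ∷ 134 ∷ 57 ∷ 26 ∷ 83 ∷ 160 ∷ 191 ∷ 99 ∷ 148 ∷ 187 ∷ 118 ∷ 69 ∷ 30 ∷
    22 ∷ 184 ∷ 11 ∷ 195 ∷ 33 ∷ 206 ∷ 162 ∷ 212 ∷ 60 ∷ 55 ∷ 5 ∷ 157 ∷ 85 ∷ 100 ∷ 32 ∷
    132 ∷ 117 ∷ 185 ∷ 163 ∷ 135 ∷ 136 ∷ 54 ∷ 82 ∷ 81 ∷ 8 ∷ 113 ∷ 96 ∷ 209 ∷ 104 ∷ 121 ∷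
    15 ∷ 16 ∷ 186 ∷ 202 ∷ 201 ∷ 31 ∷ 78 ∷ 80 ∷ 59 ∷ 139 ∷ 137 ∷ 158 ∷ 106 ∷ 23 ∷ 88 ∷
    111 ∷ 194 ∷ 129 ∷ 93 ∷ 170 ∷ 171 ∷ 124 ∷ 47 ∷ 46 ∷ []

  Pᴮ : List ℕ
  Pᴮ =
    0 ∷ 155 ∷ 62 ∷ 217 ∷ 93 ∷ 31 ∷ 218 ∷ 124 ∷ 186 ∷ 78 ∷ 9 ∷ 130 ∷ 139 ∷ 208 ∷ 87 ∷
    116 ∷ 22 ∷ 79 ∷ 101 ∷ 195 ∷ 138 ∷ 29 ∷ 212 ∷ 193 ∷ 188 ∷ 5 ∷ 24 ∷ 32 ∷ 36 ∷ 149 ∷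
    185 ∷ 181 ∷ 68 ∷ 8 ∷ 51 ∷ 158 ∷ 209 ∷ 166 ∷ 59 ∷ 151 ∷ 197 ∷ 86 ∷ 66 ∷ 20 ∷ 131 ∷
    92 ∷ 44 ∷ 81 ∷ 125 ∷ 173 ∷ 136 ∷ 109 ∷ 204 ∷ 121 ∷ 108 ∷ 13 ∷ 96 ∷ 190 ∷ 72 ∷ 172 ∷
    27 ∷ 145 ∷ 45 ∷ 60 ∷ 176 ∷ 198 ∷ 157 ∷ 41 ∷ 19 ∷ 15 ∷ 177 ∷ 25 ∷ 202 ∷ 40 ∷ 192 ∷
    39 ∷ 71 ∷ 107 ∷ 178 ∷ 146 ∷ 110 ∷ 64 ∷ 191 ∷ 179 ∷ 153 ∷ 26 ∷ 38 ∷ 123 ∷ 57 ∷ 37 ∷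
    94 ∷ 160 ∷ 180 ∷ 85 ∷ 135 ∷ 214 ∷ 132 ∷ 82 ∷ 3 ∷ 4 ∷ 113 ∷ 100 ∷ 213 ∷ 104 ∷ 117 ∷
    1 ∷ 142 ∷ 74 ∷ 216 ∷ 75 ∷ 143 ∷ 46 ∷ 106 ∷ 65 ∷ 171 ∷ 111 ∷ 152 ∷ 120 ∷ 114 ∷ 200 ∷
    97 ∷ 103 ∷ 17 ∷ 95 ∷ 134 ∷ 205 ∷ 122 ∷ 83 ∷ 12 ∷ 127 ∷ 34 ∷ 56 ∷ 50 ∷ 174 ∷ 210 ∷
    141 ∷ 48 ∷ 28 ∷ 211 ∷ 118 ∷ 105 ∷ 148 ∷ 55 ∷ 14 ∷ 183 ∷ 90 ∷ 161 ∷ 43 ∷ 167 ∷ 7 ∷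
    169 ∷ 76 ∷ 189 ∷ 99 ∷ 6 ∷ 112 ∷ 162 ∷ 69 ∷ 203 ∷ 156 ∷ 187 ∷ 91 ∷ 58 ∷ 89 ∷ 70 ∷
    16 ∷ 47 ∷ 154 ∷ 184 ∷ 215 ∷ 35 ∷ 163 ∷ 194 ∷ 77 ∷ 30 ∷ 61 ∷ 126 ∷ 128 ∷ 159 ∷ 147 ∷
    170 ∷ 201 ∷ 63 ∷ 2 ∷ 33 ∷ 182 ∷ 23 ∷ 54 ∷ 140 ∷ 102 ∷ 164 ∷ 168 ∷ 88 ∷ 150 ∷ 196 ∷
    144 ∷ 206 ∷ 84 ∷ 137 ∷ 199 ∷ 98 ∷ 165 ∷ 10 ∷ 42 ∷ 53 ∷ 115 ∷ 49 ∷ 67 ∷ 129 ∷ 21 ∷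
    11 ∷ 73 ∷ 133 ∷ 18 ∷ 80 ∷ 119 ∷ 207 ∷ 52 ∷ 175 ∷ []

  Pᶜ : List ℕ
  Pᶜ =
    0 ∷ 98 ∷ 119 ∷ 126 ∷ 7 ∷ 56 ∷ 161 ∷ 210 ∷ 91 ∷ 63 ∷ 168 ∷ 182 ∷ 35 ∷ 49 ∷ 154 ∷
    133 ∷ 105 ∷ 218 ∷ 112 ∷ 84 ∷ 217 ∷ 189 ∷ 175 ∷ 21 ∷ 196 ∷ 42 ∷ 28 ∷ 70 ∷ 140 ∷ 203 ∷
    14 ∷ 77 ∷ 147 ∷ 190 ∷ 120 ∷ 124 ∷ 93 ∷ 97 ∷ 27 ∷ 169 ∷ 58 ∷ 207 ∷ 141 ∷ 128 ∷ 165 ∷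
    10 ∷ 159 ∷ 48 ∷ 52 ∷ 89 ∷ 76 ∷ 72 ∷ 114 ∷ 31 ∷ 186 ∷ 103 ∷ 145 ∷ 134 ∷ 79 ∷ 4 ∷
    176 ∷ 107 ∷ 151 ∷ 66 ∷ 110 ∷ 41 ∷ 213 ∷ 138 ∷ 83 ∷ 155 ∷ 45 ∷ 17 ∷ 200 ∷ 172 ∷ 62 ∷
    1 ∷ 148 ∷ 68 ∷ 99 ∷ 94 ∷ 24 ∷ 162 ∷ 92 ∷ 180 ∷ 211 ∷ 38 ∷ 185 ∷ 156 ∷ 86 ∷ 192 ∷
    37 ∷ 125 ∷ 55 ∷ 100 ∷ 30 ∷ 87 ∷ 149 ∷ 69 ∷ 216 ∷ 32 ∷ 179 ∷ 6 ∷ 130 ∷ 187 ∷ 117 ∷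
    193 ∷ 123 ∷ 118 ∷ 25 ∷ 131 ∷ 61 ∷ 64 ∷ 113 ∷ 40 ∷ 71 ∷ 157 ∷ 206 ∷ 197 ∷ 29 ∷ 208 ∷
    22 ∷ 73 ∷ 122 ∷ 2 ∷ 51 ∷ 164 ∷ 9 ∷ 188 ∷ 20 ∷ 135 ∷ 184 ∷ 115 ∷ 177 ∷ 104 ∷ 153 ∷
    95 ∷ 144 ∷ 195 ∷ 102 ∷ 33 ∷ 82 ∷ 11 ∷ 60 ∷ 146 ∷ 53 ∷ 166 ∷ 215 ∷ 127 ∷ 16 ∷ 74 ∷
    43 ∷ 65 ∷ 109 ∷ 15 ∷ 205 ∷ 214 ∷ 78 ∷ 198 ∷ 158 ∷ 50 ∷ 121 ∷ 46 ∷ 183 ∷ 170 ∷ 81 ∷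
    3 ∷ 12 ∷ 202 ∷ 136 ∷ 47 ∷ 34 ∷ 108 ∷ 152 ∷ 174 ∷ 171 ∷ 96 ∷ 167 ∷ 143 ∷ 201 ∷ 90 ∷
    59 ∷ 19 ∷ 139 ∷ 36 ∷ 8 ∷ 173 ∷ 106 ∷ 178 ∷ 150 ∷ 204 ∷ 129 ∷ 101 ∷ 85 ∷ 57 ∷ 75 ∷
    191 ∷ 163 ∷ 80 ∷ 44 ∷ 209 ∷ 181 ∷ 142 ∷ 160 ∷ 132 ∷ 23 ∷ 212 ∷ 199 ∷ 67 ∷ 39 ∷ 111 ∷
    137 ∷ 54 ∷ 26 ∷ 18 ∷ 5 ∷ 194 ∷ 116 ∷ 88 ∷ 13 ∷ []

  rows : List (ℕ → ℕ)
  rows =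
    orbit P₀ [] ++
    orbit Pᴬ ((156 , 32 , 3) ∷ (127 , 176 , 30) ∷ []) ++
    orbit Pᴮ ((65 , 207 , 3) ∷ []) ++
    -- 102 is (4 , 9), and 9 generates the squares of 𝔽₃₁; one orbit covers the fifteen remaining
    -- classes of the small system on 33 points.
    orbit Pᶜ ((102 , 100 , 15) ∷ [])

  lkts : LKTS 219
  lkts = largeSetFrom rows refl refl

module Order261 where
  open CyclicRows 258 86

  P₀ : List ℕ
  P₀ =
    0 ∷ 259 ∷ 260 ∷ 42 ∷ 161 ∷ 56 ∷ 154 ∷ 119 ∷ 245 ∷ 91 ∷ 133 ∷ 35 ∷ 112 ∷ 84 ∷ 63 ∷
    7 ∷ 70 ∷ 182 ∷ 231 ∷ 49 ∷ 238 ∷ 224 ∷ 126 ∷ 168 ∷ 14 ∷ 140 ∷ 105 ∷ 203 ∷ 98 ∷ 217 ∷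
    77 ∷ 189 ∷ 252 ∷ 196 ∷ 175 ∷ 147 ∷ 21 ∷ 210 ∷ 28 ∷ 1 ∷ 100 ∷ 158 ∷ 113 ∷ 163 ∷ 242 ∷
    78 ∷ 30 ∷ 151 ∷ 8 ∷ 23 ∷ 228 ∷ 127 ∷ 9 ∷ 123 ∷ 106 ∷ 240 ∷ 172 ∷ 64 ∷ 184 ∷ 11 ∷
    239 ∷ 72 ∷ 207 ∷ 71 ∷ 107 ∷ 81 ∷ 253 ∷ 177 ∷ 88 ∷ 99 ∷ 58 ∷ 102 ∷ 50 ∷ 79 ∷ 130 ∷
    211 ∷ 121 ∷ 186 ∷ 15 ∷ 205 ∷ 39 ∷ 141 ∷ 114 ∷ 4 ∷ 134 ∷ 191 ∷ 193 ∷ 120 ∷ 86 ∷ 53 ∷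
    92 ∷ 135 ∷ 32 ∷ 36 ∷ 233 ∷ 249 ∷ 183 ∷ 170 ∷ 165 ∷ 218 ∷ 44 ∷ 256 ∷ 29 ∷ 51 ∷ 179 ∷
    169 ∷ 65 ∷ 25 ∷ 190 ∷ 93 ∷ 235 ∷ 232 ∷ 149 ∷ 137 ∷ 57 ∷ 2 ∷ 200 ∷ 225 ∷ 226 ∷ 67 ∷
    43 ∷ 156 ∷ 60 ∷ 197 ∷ 16 ∷ 46 ∷ 246 ∷ 254 ∷ 18 ∷ 85 ∷ 212 ∷ 221 ∷ 22 ∷ 128 ∷ 109 ∷
    155 ∷ 219 ∷ 144 ∷ 162 ∷ 142 ∷ 214 ∷ 176 ∷ 247 ∷ 95 ∷ 204 ∷ 198 ∷ 116 ∷ 223 ∷ 26 ∷ 10 ∷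
    76 ∷ 89 ∷ 94 ∷ 41 ∷ 215 ∷ 3 ∷ 230 ∷ 208 ∷ 80 ∷ 90 ∷ 194 ∷ 234 ∷ 69 ∷ 166 ∷ 24 ∷
    27 ∷ 110 ∷ 122 ∷ 202 ∷ 257 ∷ 59 ∷ 34 ∷ 33 ∷ 192 ∷ 216 ∷ 103 ∷ 199 ∷ 62 ∷ 243 ∷ 213 ∷
    13 ∷ 5 ∷ 241 ∷ 174 ∷ 47 ∷ 38 ∷ 237 ∷ 131 ∷ 150 ∷ 104 ∷ 40 ∷ 115 ∷ 97 ∷ 117 ∷ 45 ∷
    83 ∷ 12 ∷ 164 ∷ 55 ∷ 61 ∷ 143 ∷ 258 ∷ 159 ∷ 101 ∷ 146 ∷ 96 ∷ 17 ∷ 181 ∷ 229 ∷ 108 ∷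
    251 ∷ 236 ∷ 31 ∷ 132 ∷ 250 ∷ 136 ∷ 153 ∷ 19 ∷ 87 ∷ 195 ∷ 75 ∷ 248 ∷ 20 ∷ 187 ∷ 52 ∷
    188 ∷ 152 ∷ 178 ∷ 6 ∷ 82 ∷ 171 ∷ 160 ∷ 201 ∷ 157 ∷ 209 ∷ 180 ∷ 129 ∷ 48 ∷ 138 ∷ 73 ∷
    244 ∷ 54 ∷ 220 ∷ 118 ∷ 145 ∷ 255 ∷ 125 ∷ 68 ∷ 66 ∷ 139 ∷ 173 ∷ 206 ∷ 167 ∷ 124 ∷ 227 ∷
    148 ∷ 37 ∷ 74 ∷ 111 ∷ 222 ∷ 185 ∷ []

  Pᴬ : List ℕ
  Pᴬ =
    0 ∷ 1 ∷ 258 ∷ 113 ∷ 15 ∷ 131 ∷ 146 ∷ 244 ∷ 128 ∷ 238 ∷ 8 ∷ 13 ∷ 21 ∷ 251 ∷ 246 ∷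
    112 ∷ 64 ∷ 83 ∷ 147 ∷ 195 ∷ 176 ∷ 162 ∷ 10 ∷ 87 ∷ 97 ∷ 249 ∷ 172 ∷ 190 ∷ 85 ∷ 243 ∷
    69 ∷ 174 ∷ 16 ∷ 127 ∷ 30 ∷ 102 ∷ 132 ∷ 229 ∷ 157 ∷ 253 ∷ 218 ∷ 47 ∷ 6 ∷ 41 ∷ 212 ∷
    44 ∷ 51 ∷ 164 ∷ 215 ∷ 208 ∷ 95 ∷ 197 ∷ 227 ∷ 94 ∷ 62 ∷ 32 ∷ 165 ∷ 120 ∷ 93 ∷ 46 ∷
    139 ∷ 166 ∷ 213 ∷ 232 ∷ 86 ∷ 200 ∷ 27 ∷ 173 ∷ 59 ∷ 204 ∷ 248 ∷ 66 ∷ 55 ∷ 11 ∷ 193 ∷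
    225 ∷ 156 ∷ 137 ∷ 34 ∷ 103 ∷ 122 ∷ 92 ∷ 107 ∷ 60 ∷ 167 ∷ 152 ∷ 199 ∷ 205 ∷ 135 ∷ 178 ∷
    54 ∷ 124 ∷ 81 ∷ 78 ∷ 36 ∷ 145 ∷ 181 ∷ 223 ∷ 114 ∷ 191 ∷ 177 ∷ 150 ∷ 68 ∷ 82 ∷ 109 ∷
    58 ∷ 100 ∷ 101 ∷ 201 ∷ 159 ∷ 158 ∷ 29 ∷ 163 ∷ 67 ∷ 230 ∷ 96 ∷ 192 ∷ 254 ∷ 219 ∷ 45 ∷
    5 ∷ 40 ∷ 214 ∷ 99 ∷ 52 ∷ 108 ∷ 160 ∷ 207 ∷ 151 ∷ 183 ∷ 115 ∷ 220 ∷ 76 ∷ 144 ∷ 39 ∷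
    169 ∷ 226 ∷ 123 ∷ 90 ∷ 33 ∷ 136 ∷ 252 ∷ 141 ∷ 125 ∷ 7 ∷ 118 ∷ 134 ∷ 155 ∷ 184 ∷ 179 ∷
    104 ∷ 75 ∷ 80 ∷ 28 ∷ 255 ∷ 235 ∷ 231 ∷ 4 ∷ 24 ∷ 259 ∷ 25 ∷ 209 ∷ 260 ∷ 234 ∷ 50 ∷
    42 ∷ 239 ∷ 237 ∷ 217 ∷ 20 ∷ 22 ∷ 77 ∷ 129 ∷ 53 ∷ 182 ∷ 130 ∷ 206 ∷ 133 ∷ 38 ∷ 88 ∷
    126 ∷ 221 ∷ 171 ∷ 71 ∷ 185 ∷ 3 ∷ 188 ∷ 74 ∷ 256 ∷ 56 ∷ 17 ∷ 186 ∷ 203 ∷ 242 ∷ 73 ∷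
    148 ∷ 142 ∷ 228 ∷ 111 ∷ 117 ∷ 31 ∷ 98 ∷ 143 ∷ 18 ∷ 161 ∷ 116 ∷ 241 ∷ 105 ∷ 106 ∷ 48 ∷
    154 ∷ 153 ∷ 211 ∷ 245 ∷ 57 ∷ 216 ∷ 14 ∷ 202 ∷ 43 ∷ 189 ∷ 240 ∷ 89 ∷ 70 ∷ 19 ∷ 170 ∷
    119 ∷ 149 ∷ 250 ∷ 140 ∷ 110 ∷ 9 ∷ 91 ∷ 247 ∷ 180 ∷ 168 ∷ 12 ∷ 79 ∷ 175 ∷ 121 ∷ 222 ∷
    84 ∷ 138 ∷ 37 ∷ 63 ∷ 2 ∷ 194 ∷ 196 ∷ 257 ∷ 65 ∷ 35 ∷ 198 ∷ 26 ∷ 224 ∷ 61 ∷ 233 ∷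
    49 ∷ 23 ∷ 187 ∷ 210 ∷ 236 ∷ 72 ∷ []

  Pᴮ : List ℕ
  Pᴮ =
    0 ∷ 148 ∷ 111 ∷ 259 ∷ 37 ∷ 185 ∷ 260 ∷ 222 ∷ 74 ∷ 134 ∷ 219 ∷ 165 ∷ 125 ∷ 40 ∷ 94 ∷
    71 ∷ 2 ∷ 186 ∷ 188 ∷ 257 ∷ 73 ∷ 36 ∷ 198 ∷ 25 ∷ 223 ∷ 61 ∷ 234 ∷ 50 ∷ 16 ∷ 193 ∷
    209 ∷ 243 ∷ 66 ∷ 29 ∷ 30 ∷ 200 ∷ 230 ∷ 229 ∷ 59 ∷ 141 ∷ 128 ∷ 249 ∷ 118 ∷ 131 ∷ 10 ∷
    232 ∷ 240 ∷ 46 ∷ 27 ∷ 19 ∷ 213 ∷ 92 ∷ 247 ∷ 179 ∷ 167 ∷ 12 ∷ 80 ∷ 43 ∷ 107 ∷ 109 ∷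
    216 ∷ 152 ∷ 150 ∷ 218 ∷ 163 ∷ 137 ∷ 41 ∷ 96 ∷ 122 ∷ 85 ∷ 79 ∷ 95 ∷ 174 ∷ 180 ∷ 164 ∷
    190 ∷ 9 ∷ 60 ∷ 69 ∷ 250 ∷ 199 ∷ 162 ∷ 114 ∷ 242 ∷ 97 ∷ 145 ∷ 17 ∷ 225 ∷ 72 ∷ 221 ∷
    34 ∷ 187 ∷ 38 ∷ 1 ∷ 135 ∷ 123 ∷ 258 ∷ 124 ∷ 136 ∷ 246 ∷ 58 ∷ 214 ∷ 13 ∷ 201 ∷ 45 ∷
    8 ∷ 44 ∷ 207 ∷ 251 ∷ 215 ∷ 52 ∷ 155 ∷ 205 ∷ 158 ∷ 104 ∷ 54 ∷ 101 ∷ 64 ∷ 93 ∷ 102 ∷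
    195 ∷ 166 ∷ 157 ∷ 204 ∷ 86 ∷ 228 ∷ 55 ∷ 173 ∷ 31 ∷ 253 ∷ 226 ∷ 39 ∷ 6 ∷ 33 ∷ 220 ∷
    78 ∷ 170 ∷ 11 ∷ 181 ∷ 89 ∷ 248 ∷ 211 ∷ 254 ∷ 53 ∷ 48 ∷ 5 ∷ 206 ∷ 106 ∷ 65 ∷ 88 ∷
    153 ∷ 194 ∷ 171 ∷ 113 ∷ 76 ∷ 70 ∷ 127 ∷ 90 ∷ 42 ∷ 239 ∷ 202 ∷ 77 ∷ 99 ∷ 62 ∷ 98 ∷
    15 ∷ 237 ∷ 7 ∷ 120 ∷ 83 ∷ 56 ∷ 183 ∷ 146 ∷ 189 ∷ 169 ∷ 132 ∷ 217 ∷ 57 ∷ 20 ∷ 182 ∷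
    197 ∷ 160 ∷ 161 ∷ 22 ∷ 244 ∷ 252 ∷ 176 ∷ 139 ∷ 203 ∷ 149 ∷ 75 ∷ 35 ∷ 156 ∷ 82 ∷ 21 ∷
    212 ∷ 138 ∷ 168 ∷ 142 ∷ 68 ∷ 49 ∷ 100 ∷ 26 ∷ 133 ∷ 23 ∷ 208 ∷ 28 ∷ 184 ∷ 110 ∷ 224 ∷
    177 ∷ 103 ∷ 238 ∷ 121 ∷ 47 ∷ 91 ∷ 191 ∷ 117 ∷ 210 ∷ 233 ∷ 159 ∷ 126 ∷ 51 ∷ 236 ∷ 231 ∷
    4 ∷ 115 ∷ 140 ∷ 32 ∷ 143 ∷ 84 ∷ 256 ∷ 108 ∷ 154 ∷ 235 ∷ 87 ∷ 196 ∷ 67 ∷ 178 ∷ 14 ∷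
    18 ∷ 129 ∷ 112 ∷ 144 ∷ 255 ∷ 119 ∷ 116 ∷ 227 ∷ 175 ∷ 151 ∷ 3 ∷ 105 ∷ 172 ∷ 24 ∷ 63 ∷
    81 ∷ 192 ∷ 245 ∷ 130 ∷ 241 ∷ 147 ∷ []

  Pᶜ₁ : List ℕ
  Pᶜ₁ =
    0 ∷ 168 ∷ 175 ∷ 112 ∷ 196 ∷ 161 ∷ 77 ∷ 210 ∷ 140 ∷ 154 ∷ 126 ∷ 28 ∷ 224 ∷ 189 ∷ 84 ∷
    7 ∷ 238 ∷ 133 ∷ 217 ∷ 182 ∷ 147 ∷ 91 ∷ 56 ∷ 63 ∷ 231 ∷ 21 ∷ 259 ∷ 42 ∷ 119 ∷ 70 ∷
    14 ∷ 245 ∷ 98 ∷ 49 ∷ 252 ∷ 260 ∷ 203 ∷ 105 ∷ 35 ∷ 8 ∷ 29 ∷ 222 ∷ 37 ∷ 230 ∷ 251 ∷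
    232 ∷ 156 ∷ 130 ∷ 64 ∷ 177 ∷ 18 ∷ 129 ∷ 103 ∷ 27 ∷ 241 ∷ 82 ∷ 195 ∷ 1 ∷ 121 ∷ 137 ∷
    36 ∷ 212 ∷ 11 ∷ 122 ∷ 138 ∷ 258 ∷ 248 ∷ 47 ∷ 223 ∷ 127 ∷ 149 ∷ 242 ∷ 169 ∷ 184 ∷ 165 ∷
    17 ∷ 110 ∷ 132 ∷ 94 ∷ 75 ∷ 90 ∷ 148 ∷ 164 ∷ 206 ∷ 53 ∷ 95 ∷ 111 ∷ 233 ∷ 23 ∷ 3 ∷
    51 ∷ 100 ∷ 108 ∷ 151 ∷ 159 ∷ 208 ∷ 256 ∷ 236 ∷ 26 ∷ 225 ∷ 205 ∷ 88 ∷ 71 ∷ 128 ∷ 60 ∷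
    199 ∷ 131 ∷ 188 ∷ 171 ∷ 54 ∷ 34 ∷ 239 ∷ 58 ∷ 221 ∷ 57 ∷ 16 ∷ 186 ∷ 38 ∷ 201 ∷ 20 ∷
    73 ∷ 243 ∷ 202 ∷ 85 ∷ 134 ∷ 40 ∷ 162 ∷ 211 ∷ 145 ∷ 114 ∷ 48 ∷ 97 ∷ 219 ∷ 125 ∷ 174 ∷
    92 ∷ 101 ∷ 66 ∷ 204 ∷ 45 ∷ 10 ∷ 193 ∷ 158 ∷ 167 ∷ 249 ∷ 214 ∷ 55 ∷ 240 ∷ 93 ∷ 185 ∷
    74 ∷ 166 ∷ 19 ∷ 190 ∷ 192 ∷ 136 ∷ 155 ∷ 99 ∷ 5 ∷ 197 ∷ 141 ∷ 180 ∷ 106 ∷ 234 ∷ 178 ∷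
    79 ∷ 118 ∷ 62 ∷ 44 ∷ 247 ∷ 227 ∷ 86 ∷ 30 ∷ 143 ∷ 254 ∷ 160 ∷ 104 ∷ 116 ∷ 229 ∷ 173 ∷
    81 ∷ 25 ∷ 153 ∷ 123 ∷ 67 ∷ 69 ∷ 32 ∷ 12 ∷ 215 ∷ 113 ∷ 253 ∷ 152 ∷ 78 ∷ 150 ∷ 31 ∷
    43 ∷ 183 ∷ 33 ∷ 218 ∷ 80 ∷ 220 ∷ 2 ∷ 142 ∷ 115 ∷ 226 ∷ 76 ∷ 216 ∷ 191 ∷ 72 ∷ 255 ∷
    107 ∷ 6 ∷ 146 ∷ 39 ∷ 179 ∷ 41 ∷ 4 ∷ 187 ∷ 68 ∷ 228 ∷ 109 ∷ 181 ∷ 144 ∷ 117 ∷ 257 ∷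
    120 ∷ 163 ∷ 235 ∷ 50 ∷ 9 ∷ 200 ∷ 15 ∷ 198 ∷ 46 ∷ 22 ∷ 135 ∷ 102 ∷ 246 ∷ 65 ∷ 207 ∷
    176 ∷ 170 ∷ 172 ∷ 157 ∷ 124 ∷ 237 ∷ 87 ∷ 89 ∷ 83 ∷ 52 ∷ 194 ∷ 13 ∷ 59 ∷ 250 ∷ 209 ∷
    24 ∷ 96 ∷ 139 ∷ 213 ∷ 61 ∷ 244 ∷ []

  Pᶜ₂ : List ℕ
  Pᶜ₂ =
    0 ∷ 245 ∷ 182 ∷ 112 ∷ 77 ∷ 98 ∷ 84 ∷ 14 ∷ 175 ∷ 238 ∷ 217 ∷ 70 ∷ 231 ∷ 63 ∷ 252 ∷
    49 ∷ 91 ∷ 105 ∷ 224 ∷ 7 ∷ 140 ∷ 119 ∷ 126 ∷ 260 ∷ 154 ∷ 196 ∷ 21 ∷ 189 ∷ 161 ∷ 28 ∷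
    42 ∷ 203 ∷ 259 ∷ 56 ∷ 133 ∷ 210 ∷ 168 ∷ 35 ∷ 147 ∷ 16 ∷ 58 ∷ 185 ∷ 74 ∷ 201 ∷ 243 ∷
    205 ∷ 53 ∷ 1 ∷ 128 ∷ 95 ∷ 36 ∷ 258 ∷ 206 ∷ 54 ∷ 223 ∷ 164 ∷ 131 ∷ 2 ∷ 242 ∷ 15 ∷
    72 ∷ 165 ∷ 22 ∷ 244 ∷ 17 ∷ 257 ∷ 237 ∷ 94 ∷ 187 ∷ 254 ∷ 39 ∷ 225 ∷ 79 ∷ 109 ∷ 71 ∷
    34 ∷ 220 ∷ 5 ∷ 188 ∷ 150 ∷ 180 ∷ 37 ∷ 69 ∷ 153 ∷ 106 ∷ 190 ∷ 222 ∷ 207 ∷ 46 ∷ 6 ∷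
    102 ∷ 200 ∷ 216 ∷ 43 ∷ 59 ∷ 157 ∷ 253 ∷ 213 ∷ 52 ∷ 191 ∷ 151 ∷ 176 ∷ 142 ∷ 256 ∷ 120 ∷
    139 ∷ 3 ∷ 117 ∷ 83 ∷ 108 ∷ 68 ∷ 219 ∷ 116 ∷ 183 ∷ 114 ∷ 32 ∷ 113 ∷ 76 ∷ 143 ∷ 40 ∷
    146 ∷ 227 ∷ 145 ∷ 170 ∷ 9 ∷ 80 ∷ 65 ∷ 163 ∷ 31 ∷ 228 ∷ 96 ∷ 194 ∷ 179 ∷ 250 ∷ 89 ∷
    184 ∷ 202 ∷ 132 ∷ 149 ∷ 90 ∷ 20 ∷ 127 ∷ 57 ∷ 75 ∷ 239 ∷ 169 ∷ 110 ∷ 221 ∷ 186 ∷ 111 ∷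
    148 ∷ 73 ∷ 38 ∷ 121 ∷ 125 ∷ 13 ∷ 51 ∷ 198 ∷ 10 ∷ 135 ∷ 23 ∷ 101 ∷ 212 ∷ 209 ∷ 97 ∷
    158 ∷ 236 ∷ 124 ∷ 88 ∷ 235 ∷ 195 ∷ 172 ∷ 60 ∷ 27 ∷ 249 ∷ 61 ∷ 208 ∷ 232 ∷ 199 ∷ 87 ∷
    162 ∷ 50 ∷ 47 ∷ 246 ∷ 134 ∷ 138 ∷ 64 ∷ 24 ∷ 171 ∷ 226 ∷ 247 ∷ 45 ∷ 156 ∷ 41 ∷ 62 ∷
    86 ∷ 107 ∷ 66 ∷ 177 ∷ 160 ∷ 181 ∷ 4 ∷ 25 ∷ 230 ∷ 193 ∷ 152 ∷ 173 ∷ 123 ∷ 144 ∷ 251 ∷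
    214 ∷ 12 ∷ 33 ∷ 78 ∷ 99 ∷ 82 ∷ 8 ∷ 115 ∷ 136 ∷ 197 ∷ 218 ∷ 103 ∷ 29 ∷ 234 ∷ 255 ∷
    240 ∷ 67 ∷ 211 ∷ 100 ∷ 18 ∷ 141 ∷ 30 ∷ 137 ∷ 92 ∷ 44 ∷ 11 ∷ 204 ∷ 233 ∷ 130 ∷ 155 ∷
    93 ∷ 81 ∷ 85 ∷ 55 ∷ 248 ∷ 215 ∷ 174 ∷ 178 ∷ 166 ∷ 104 ∷ 129 ∷ 26 ∷ 118 ∷ 241 ∷ 159 ∷
    48 ∷ 192 ∷ 19 ∷ 167 ∷ 122 ∷ 229 ∷ []

  rows : List (ℕ → ℕ)
  rows =
    orbit P₀ [] ++
    orbit Pᴬ ((149 , 186 , 3) ∷ (113 , 204 , 36) ∷ []) ++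
    orbit Pᴮ ((2 , 130 , 3) ∷ []) ++
    -- 16 has order 9 modulo 37, so two orbits give the eighteen remaining classes of the small
    -- system on 39 points.
    orbit Pᶜ₁ ((16 , 81 , 9) ∷ []) ++
    orbit Pᶜ₂ ((16 , 81 , 9) ∷ [])

  lkts : LKTS 261
  lkts = largeSetFrom rows refl refl

module Order303 where
  open CyclicRows 300 100

  P₀ : List ℕ
  P₀ =
    0 ∷ 301 ∷ 302 ∷ 259 ∷ 49 ∷ 294 ∷ 133 ∷ 273 ∷ 196 ∷ 224 ∷ 140 ∷ 238 ∷ 182 ∷ 231 ∷ 189 ∷
    56 ∷ 35 ∷ 210 ∷ 14 ∷ 203 ∷ 84 ∷ 21 ∷ 154 ∷ 126 ∷ 217 ∷ 98 ∷ 287 ∷ 175 ∷ 147 ∷ 280 ∷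
    91 ∷ 266 ∷ 245 ∷ 7 ∷ 252 ∷ 42 ∷ 105 ∷ 28 ∷ 168 ∷ 63 ∷ 161 ∷ 77 ∷ 112 ∷ 70 ∷ 119 ∷
    1 ∷ 79 ∷ 221 ∷ 218 ∷ 65 ∷ 18 ∷ 267 ∷ 23 ∷ 11 ∷ 113 ∷ 198 ∷ 291 ∷ 253 ∷ 121 ∷ 228 ∷
    71 ∷ 191 ∷ 39 ∷ 127 ∷ 100 ∷ 74 ∷ 295 ∷ 128 ∷ 179 ∷ 197 ∷ 212 ∷ 193 ∷ 204 ∷ 163 ∷ 235 ∷
    225 ∷ 16 ∷ 60 ∷ 288 ∷ 177 ∷ 137 ∷ 176 ∷ 58 ∷ 67 ∷ 141 ∷ 2 ∷ 158 ∷ 36 ∷ 135 ∷ 130 ∷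
    22 ∷ 233 ∷ 46 ∷ 281 ∷ 226 ∷ 95 ∷ 155 ∷ 205 ∷ 242 ∷ 78 ∷ 142 ∷ 81 ∷ 148 ∷ 254 ∷ 200 ∷
    57 ∷ 289 ∷ 256 ∷ 85 ∷ 93 ∷ 123 ∷ 169 ∷ 107 ∷ 25 ∷ 120 ∷ 149 ∷ 32 ∷ 274 ∷ 275 ∷ 53 ∷
    134 ∷ 51 ∷ 116 ∷ 15 ∷ 282 ∷ 4 ∷ 260 ∷ 72 ∷ 270 ∷ 92 ∷ 44 ∷ 165 ∷ 190 ∷ 261 ∷ 151 ∷
    183 ∷ 9 ∷ 109 ∷ 162 ∷ 156 ∷ 284 ∷ 99 ∷ 296 ∷ 207 ∷ 211 ∷ 114 ∷ 277 ∷ 246 ∷ 170 ∷ 186 ∷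
    50 ∷ 37 ∷ 214 ∷ 64 ∷ 240 ∷ 298 ∷ 106 ∷ 247 ∷ 249 ∷ 232 ∷ 268 ∷ 102 ∷ 8 ∷ 30 ∷ 263 ∷
    239 ∷ 219 ∷ 144 ∷ 29 ∷ 184 ∷ 88 ∷ 216 ∷ 208 ∷ 178 ∷ 132 ∷ 194 ∷ 276 ∷ 181 ∷ 152 ∷ 269 ∷
    27 ∷ 26 ∷ 248 ∷ 167 ∷ 250 ∷ 185 ∷ 286 ∷ 19 ∷ 297 ∷ 41 ∷ 229 ∷ 31 ∷ 209 ∷ 257 ∷ 136 ∷
    111 ∷ 40 ∷ 150 ∷ 118 ∷ 292 ∷ 192 ∷ 139 ∷ 145 ∷ 17 ∷ 202 ∷ 5 ∷ 94 ∷ 90 ∷ 187 ∷ 24 ∷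
    55 ∷ 131 ∷ 115 ∷ 251 ∷ 264 ∷ 87 ∷ 237 ∷ 61 ∷ 3 ∷ 195 ∷ 54 ∷ 52 ∷ 69 ∷ 33 ∷ 199 ∷
    293 ∷ 271 ∷ 38 ∷ 62 ∷ 82 ∷ 157 ∷ 272 ∷ 117 ∷ 213 ∷ 300 ∷ 222 ∷ 80 ∷ 83 ∷ 236 ∷ 283 ∷
    34 ∷ 278 ∷ 290 ∷ 188 ∷ 103 ∷ 10 ∷ 48 ∷ 180 ∷ 73 ∷ 230 ∷ 110 ∷ 262 ∷ 174 ∷ 201 ∷ 227 ∷
    6 ∷ 173 ∷ 122 ∷ 104 ∷ 89 ∷ 108 ∷ 97 ∷ 138 ∷ 66 ∷ 76 ∷ 285 ∷ 241 ∷ 13 ∷ 124 ∷ 164 ∷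
    125 ∷ 243 ∷ 234 ∷ 160 ∷ 299 ∷ 143 ∷ 265 ∷ 166 ∷ 171 ∷ 279 ∷ 68 ∷ 255 ∷ 20 ∷ 75 ∷ 206 ∷
    146 ∷ 96 ∷ 59 ∷ 223 ∷ 159 ∷ 220 ∷ 153 ∷ 47 ∷ 101 ∷ 244 ∷ 12 ∷ 45 ∷ 43 ∷ 86 ∷ 172 ∷
    258 ∷ 215 ∷ 129 ∷ []

  Pᴬ : List ℕ
  Pᴬ =
    0 ∷ 1 ∷ 300 ∷ 218 ∷ 205 ∷ 179 ∷ 83 ∷ 96 ∷ 122 ∷ 225 ∷ 93 ∷ 284 ∷ 76 ∷ 208 ∷ 17 ∷
    50 ∷ 58 ∷ 193 ∷ 251 ∷ 243 ∷ 108 ∷ 191 ∷ 170 ∷ 241 ∷ 110 ∷ 131 ∷ 60 ∷ 190 ∷ 16 ∷ 95 ∷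
    111 ∷ 285 ∷ 206 ∷ 57 ∷ 15 ∷ 229 ∷ 244 ∷ 286 ∷ 72 ∷ 289 ∷ 163 ∷ 150 ∷ 12 ∷ 138 ∷ 151 ∷
    22 ∷ 155 ∷ 124 ∷ 279 ∷ 146 ∷ 177 ∷ 226 ∷ 100 ∷ 276 ∷ 75 ∷ 201 ∷ 25 ∷ 239 ∷ 142 ∷ 221 ∷
    62 ∷ 159 ∷ 80 ∷ 51 ∷ 65 ∷ 185 ∷ 250 ∷ 236 ∷ 116 ∷ 219 ∷ 282 ∷ 101 ∷ 82 ∷ 19 ∷ 200 ∷
    295 ∷ 79 ∷ 228 ∷ 6 ∷ 222 ∷ 73 ∷ 113 ∷ 156 ∷ 32 ∷ 188 ∷ 145 ∷ 269 ∷ 44 ∷ 212 ∷ 45 ∷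
    257 ∷ 89 ∷ 256 ∷ 197 ∷ 247 ∷ 158 ∷ 104 ∷ 54 ∷ 143 ∷ 261 ∷ 121 ∷ 220 ∷ 40 ∷ 180 ∷ 81 ∷
    92 ∷ 10 ∷ 199 ∷ 209 ∷ 291 ∷ 102 ∷ 288 ∷ 2 ∷ 11 ∷ 13 ∷ 299 ∷ 290 ∷ 232 ∷ 115 ∷ 255 ∷
    69 ∷ 186 ∷ 46 ∷ 134 ∷ 136 ∷ 31 ∷ 167 ∷ 165 ∷ 270 ∷ 9 ∷ 268 ∷ 24 ∷ 292 ∷ 33 ∷ 277 ∷
    71 ∷ 3 ∷ 227 ∷ 230 ∷ 298 ∷ 74 ∷ 260 ∷ 59 ∷ 283 ∷ 41 ∷ 242 ∷ 18 ∷ 275 ∷ 114 ∷ 213 ∷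
    26 ∷ 187 ∷ 88 ∷ 176 ∷ 178 ∷ 248 ∷ 125 ∷ 123 ∷ 53 ∷ 189 ∷ 281 ∷ 132 ∷ 112 ∷ 20 ∷ 169 ∷
    203 ∷ 37 ∷ 61 ∷ 98 ∷ 264 ∷ 240 ∷ 56 ∷ 198 ∷ 47 ∷ 245 ∷ 103 ∷ 254 ∷ 35 ∷ 296 ∷ 271 ∷
    266 ∷ 5 ∷ 30 ∷ 252 ∷ 135 ∷ 215 ∷ 49 ∷ 166 ∷ 86 ∷ 217 ∷ 233 ∷ 152 ∷ 84 ∷ 68 ∷ 149 ∷
    43 ∷ 23 ∷ 235 ∷ 258 ∷ 278 ∷ 66 ∷ 224 ∷ 184 ∷ 194 ∷ 77 ∷ 117 ∷ 107 ∷ 301 ∷ 64 ∷ 173 ∷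
    302 ∷ 237 ∷ 128 ∷ 7 ∷ 157 ∷ 137 ∷ 294 ∷ 144 ∷ 164 ∷ 28 ∷ 183 ∷ 90 ∷ 273 ∷ 118 ∷ 211 ∷
    85 ∷ 129 ∷ 87 ∷ 216 ∷ 172 ∷ 214 ∷ 196 ∷ 297 ∷ 109 ∷ 105 ∷ 4 ∷ 192 ∷ 133 ∷ 38 ∷ 130 ∷
    168 ∷ 263 ∷ 171 ∷ 210 ∷ 52 ∷ 39 ∷ 91 ∷ 249 ∷ 262 ∷ 161 ∷ 234 ∷ 207 ∷ 140 ∷ 67 ∷ 94 ∷
    70 ∷ 204 ∷ 27 ∷ 231 ∷ 97 ∷ 274 ∷ 63 ∷ 36 ∷ 202 ∷ 238 ∷ 265 ∷ 99 ∷ 175 ∷ 267 ∷ 160 ∷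
    126 ∷ 34 ∷ 141 ∷ 154 ∷ 253 ∷ 195 ∷ 147 ∷ 48 ∷ 106 ∷ 119 ∷ 127 ∷ 55 ∷ 182 ∷ 174 ∷ 246 ∷
    42 ∷ 78 ∷ 181 ∷ 259 ∷ 223 ∷ 120 ∷ 14 ∷ 148 ∷ 139 ∷ 287 ∷ 153 ∷ 162 ∷ 21 ∷ 8 ∷ 272 ∷
    280 ∷ 293 ∷ 29 ∷ []

  Pᴮ : List ℕ
  Pᴮ =
    0 ∷ 43 ∷ 258 ∷ 301 ∷ 86 ∷ 129 ∷ 302 ∷ 215 ∷ 172 ∷ 71 ∷ 156 ∷ 74 ∷ 230 ∷ 145 ∷ 227 ∷
    78 ∷ 296 ∷ 228 ∷ 223 ∷ 5 ∷ 73 ∷ 197 ∷ 170 ∷ 235 ∷ 104 ∷ 131 ∷ 66 ∷ 85 ∷ 37 ∷ 179 ∷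
    216 ∷ 264 ∷ 122 ∷ 288 ∷ 247 ∷ 67 ∷ 13 ∷ 54 ∷ 234 ∷ 274 ∷ 268 ∷ 60 ∷ 27 ∷ 33 ∷ 241 ∷
    36 ∷ 219 ∷ 46 ∷ 265 ∷ 82 ∷ 255 ∷ 260 ∷ 184 ∷ 158 ∷ 41 ∷ 117 ∷ 143 ∷ 155 ∷ 65 ∷ 81 ∷
    146 ∷ 236 ∷ 220 ∷ 183 ∷ 23 ∷ 95 ∷ 118 ∷ 278 ∷ 206 ∷ 57 ∷ 121 ∷ 123 ∷ 244 ∷ 180 ∷ 178 ∷
    211 ∷ 191 ∷ 200 ∷ 90 ∷ 110 ∷ 101 ∷ 120 ∷ 128 ∷ 53 ∷ 181 ∷ 173 ∷ 248 ∷ 64 ∷ 212 ∷ 25 ∷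
    237 ∷ 89 ∷ 276 ∷ 15 ∷ 16 ∷ 270 ∷ 286 ∷ 285 ∷ 31 ∷ 8 ∷ 177 ∷ 116 ∷ 293 ∷ 124 ∷ 185 ∷
    190 ∷ 2 ∷ 109 ∷ 111 ∷ 299 ∷ 192 ∷ 1 ∷ 135 ∷ 165 ∷ 300 ∷ 166 ∷ 136 ∷ 99 ∷ 226 ∷ 277 ∷
    202 ∷ 75 ∷ 24 ∷ 113 ∷ 205 ∷ 284 ∷ 188 ∷ 96 ∷ 17 ∷ 50 ∷ 254 ∷ 298 ∷ 251 ∷ 47 ∷ 3 ∷
    127 ∷ 289 ∷ 186 ∷ 174 ∷ 12 ∷ 115 ∷ 232 ∷ 107 ∷ 263 ∷ 69 ∷ 194 ∷ 38 ∷ 204 ∷ 149 ∷ 249 ∷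
    97 ∷ 152 ∷ 52 ∷ 29 ∷ 51 ∷ 221 ∷ 272 ∷ 250 ∷ 80 ∷ 176 ∷ 282 ∷ 144 ∷ 125 ∷ 19 ∷ 157 ∷
    267 ∷ 44 ∷ 291 ∷ 34 ∷ 257 ∷ 10 ∷ 22 ∷ 261 ∷ 18 ∷ 279 ∷ 40 ∷ 283 ∷ 218 ∷ 132 ∷ 252 ∷
    253 ∷ 167 ∷ 182 ∷ 295 ∷ 209 ∷ 98 ∷ 225 ∷ 139 ∷ 238 ∷ 141 ∷ 55 ∷ 105 ∷ 281 ∷ 195 ∷ 126 ∷
    148 ∷ 62 ∷ 91 ∷ 169 ∷ 83 ∷ 49 ∷ 134 ∷ 48 ∷ 119 ∷ 92 ∷ 6 ∷ 203 ∷ 162 ∷ 76 ∷ 63 ∷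
    246 ∷ 160 ∷ 196 ∷ 106 ∷ 20 ∷ 175 ∷ 239 ∷ 153 ∷ 210 ∷ 9 ∷ 138 ∷ 154 ∷ 114 ∷ 243 ∷ 245 ∷
    240 ∷ 68 ∷ 294 ∷ 30 ∷ 159 ∷ 112 ∷ 79 ∷ 208 ∷ 14 ∷ 198 ∷ 26 ∷ 77 ∷ 100 ∷ 229 ∷ 273 ∷
    163 ∷ 292 ∷ 147 ∷ 58 ∷ 187 ∷ 56 ∷ 233 ∷ 61 ∷ 7 ∷ 142 ∷ 271 ∷ 189 ∷ 93 ∷ 222 ∷ 287 ∷
    275 ∷ 103 ∷ 224 ∷ 72 ∷ 201 ∷ 28 ∷ 130 ∷ 87 ∷ 84 ∷ 242 ∷ 199 ∷ 161 ∷ 256 ∷ 213 ∷ 133 ∷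
    32 ∷ 290 ∷ 280 ∷ 4 ∷ 262 ∷ 35 ∷ 151 ∷ 108 ∷ 42 ∷ 207 ∷ 164 ∷ 231 ∷ 214 ∷ 171 ∷ 217 ∷
    102 ∷ 59 ∷ 140 ∷ 88 ∷ 45 ∷ 168 ∷ 11 ∷ 269 ∷ 21 ∷ 39 ∷ 297 ∷ 266 ∷ 193 ∷ 150 ∷ 259 ∷
    137 ∷ 94 ∷ 70 ∷ []

  Pᶜ : List ℕ
  Pᶜ =
    0 ∷ 280 ∷ 210 ∷ 259 ∷ 252 ∷ 84 ∷ 91 ∷ 224 ∷ 56 ∷ 189 ∷ 203 ∷ 294 ∷ 133 ∷ 49 ∷ 112 ∷
    196 ∷ 154 ∷ 77 ∷ 273 ∷ 231 ∷ 42 ∷ 147 ∷ 238 ∷ 302 ∷ 140 ∷ 161 ∷ 126 ∷ 175 ∷ 182 ∷ 98 ∷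
    7 ∷ 21 ∷ 245 ∷ 14 ∷ 28 ∷ 301 ∷ 217 ∷ 63 ∷ 35 ∷ 266 ∷ 119 ∷ 168 ∷ 105 ∷ 70 ∷ 287 ∷
    64 ∷ 22 ∷ 215 ∷ 86 ∷ 279 ∷ 237 ∷ 15 ∷ 65 ∷ 221 ∷ 71 ∷ 107 ∷ 123 ∷ 178 ∷ 194 ∷ 230 ∷
    80 ∷ 236 ∷ 286 ∷ 92 ∷ 58 ∷ 151 ∷ 295 ∷ 114 ∷ 193 ∷ 150 ∷ 243 ∷ 209 ∷ 108 ∷ 187 ∷ 6 ∷
    135 ∷ 37 ∷ 129 ∷ 172 ∷ 264 ∷ 166 ∷ 43 ∷ 101 ∷ 157 ∷ 144 ∷ 200 ∷ 258 ∷ 260 ∷ 162 ∷ 180 ∷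
    8 ∷ 45 ∷ 248 ∷ 225 ∷ 127 ∷ 250 ∷ 78 ∷ 10 ∷ 213 ∷ 2 ∷ 205 ∷ 94 ∷ 51 ∷ 174 ∷ 76 ∷
    268 ∷ 170 ∷ 164 ∷ 121 ∷ 139 ∷ 41 ∷ 88 ∷ 291 ∷ 223 ∷ 137 ∷ 131 ∷ 33 ∷ 53 ∷ 256 ∷ 293 ∷
    207 ∷ 96 ∷ 299 ∷ 218 ∷ 281 ∷ 103 ∷ 232 ∷ 3 ∷ 66 ∷ 106 ∷ 169 ∷ 26 ∷ 155 ∷ 192 ∷ 255 ∷
    261 ∷ 23 ∷ 17 ∷ 275 ∷ 132 ∷ 195 ∷ 149 ∷ 212 ∷ 241 ∷ 198 ∷ 20 ∷ 83 ∷ 46 ∷ 109 ∷ 146 ∷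
    60 ∷ 89 ∷ 152 ∷ 235 ∷ 298 ∷ 69 ∷ 284 ∷ 278 ∷ 40 ∷ 134 ∷ 282 ∷ 186 ∷ 57 ∷ 177 ∷ 67 ∷
    148 ∷ 72 ∷ 81 ∷ 239 ∷ 100 ∷ 263 ∷ 29 ∷ 296 ∷ 277 ∷ 253 ∷ 191 ∷ 158 ∷ 220 ∷ 229 ∷ 153 ∷
    143 ∷ 110 ∷ 48 ∷ 234 ∷ 124 ∷ 244 ∷ 24 ∷ 5 ∷ 272 ∷ 115 ∷ 19 ∷ 167 ∷ 38 ∷ 201 ∷ 62 ∷
    1 ∷ 30 ∷ 270 ∷ 141 ∷ 44 ∷ 116 ∷ 99 ∷ 289 ∷ 214 ∷ 288 ∷ 184 ∷ 130 ∷ 246 ∷ 128 ∷ 228 ∷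
    85 ∷ 142 ∷ 74 ∷ 87 ∷ 12 ∷ 202 ∷ 227 ∷ 159 ∷ 216 ∷ 185 ∷ 257 ∷ 160 ∷ 73 ∷ 173 ∷ 55 ∷
    31 ∷ 271 ∷ 300 ∷ 171 ∷ 117 ∷ 13 ∷ 176 ∷ 247 ∷ 179 ∷ 50 ∷ 219 ∷ 32 ∷ 183 ∷ 79 ∷ 39 ∷
    204 ∷ 93 ∷ 4 ∷ 36 ∷ 254 ∷ 11 ∷ 211 ∷ 226 ∷ 165 ∷ 262 ∷ 222 ∷ 118 ∷ 136 ∷ 75 ∷ 90 ∷
    269 ∷ 82 ∷ 251 ∷ 290 ∷ 47 ∷ 265 ∷ 122 ∷ 54 ∷ 125 ∷ 297 ∷ 208 ∷ 97 ∷ 267 ∷ 59 ∷ 276 ∷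
    274 ∷ 190 ∷ 138 ∷ 197 ∷ 113 ∷ 292 ∷ 120 ∷ 283 ∷ 199 ∷ 9 ∷ 188 ∷ 104 ∷ 16 ∷ 233 ∷ 52 ∷
    240 ∷ 156 ∷ 206 ∷ 163 ∷ 111 ∷ 27 ∷ 95 ∷ 145 ∷ 61 ∷ 102 ∷ 18 ∷ 181 ∷ 25 ∷ 242 ∷ 34 ∷
    249 ∷ 68 ∷ 285 ∷ []

  rows : List (ℕ → ℕ)
  rows =
    orbit P₀ [] ++
    orbit Pᴬ ((44 , 130 , 3) ∷ (218 , 29 , 42) ∷ []) ++
    orbit Pᴮ ((9 , 67 , 3) ∷ []) ++
    -- 9 generates the squares of 𝔽₄₃, of order 21: one class for each remaining class of the small
    -- system on 45 points.
    orbit Pᶜ ((9 , 67 , 21) ∷ [])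

  lkts : LKTS 303
  lkts = largeSetFrom rows refl refl

corollary3p8 : LKTS 93 × LKTS 177 × LKTS 219 × LKTS 261 × LKTS 303
corollary3p8 = Order93.lkts , Order177.lkts , Order219.lkts , Order261.lkts , Order303.lkts
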